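{- Let $(\mathbf S,\mathbf M)$ be an unpunctured non-orientable marked surface with a triangulation $T$ and a principal lamination $\mathcal L_T$. Let $\alpha$ be a one-sided closed curve, and let $\alpha^2$ be the two-sided closed curve enclosing the crosscap obtained from resolving an intersection of $\alpha$ with another one-sided closed curve homotopic to $\alpha$. Then $$(\overline\chi_{\alpha,\mathcal L_T})^2=\overline\chi_{\alpha^2,\mathcal L_T}-2.$$
   Context: **Surfaces.** $\mathbf S$ is a compact connected surface with boundary, $\mathbf M\subset\partial\mathbf S$ a finite set of marked points meeting every boundary component. An arc is a simple curve (up to isotopy) with endpoints in $\mathbf M$, otherwise disjoint from $\mathbf M\cup\partial\mathbf S$, not cutting out a monogon or bigon. A triangulation $T$ is a maximal collection of pairwise non-crossing arcs (with no one-sided closed curve). Each arc or boundary segment $\tau$ has a variable $x_\tau$, and each arc $\tau\in T$ a variable $y_\tau$. A closed curve is one-sided if it has no orientable regular neighbourhood. Curves are considered up to isotopy and are drawn with the minimal number of crossings with $T$. The curve $\alpha^2$ is the closed curve of multiplicity two along $\alpha$ (i.e. $\alpha$ traversed twice; its lift to the orientable double cover is the concatenation of the two lifts of $\alpha$). **Principal laminations and signs.** For each $\tau\in T$, $L_\tau$ is a lamination associated to $\tau$: a non-self-intersecting curve running along $\tau$ in a small neighbourhood which at both ends turns clockwise (or at both ends counterclockwise, directions being transported along $\tau$) and ends on the boundary near the endpoint of $\tau$; when this would self-intersect, it is the corresponding one-sided closed curve instead. There are two choices for each $\tau$; a principal lamination is a choice $\mathcal L_T=\{L_\tau:\tau\in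 T\}$. Points of the orientable double cover of $\mathbf S$ are pairs (point of $\mathbf S$, local orientation there). For a lift $\tau'$ of $\tau$, let $b_T(\mathcal L_T,\tau')$ be the shear coordinate at $\tau'$ of the preimage of $L_\tau$, i.e. the number of $S$-intersections minus the number of $Z$-intersections with the quadrilateral of the lifted triangulation having $\tau'$ as diagonal. (A directed segment crossing a side, then $\tau'$, then the opposite side is an $S$-intersection if the common endpoint of the first side and $\tau'$ lies to its right and the common endpoint of $\tau'$ and the last side lies to its left; a $Z$-intersection with left and right exchanged.) One has $b_T(\mathcal L_T,\tau')\in\{1,-1\}$, and the two lifts of $\tau$ have opposite signs. For a point of $\tau$ with a local orientation, $b_T(\mathcal L_T,\tau)$ denotes the sign of the corresponding lift. **Elementary steps (determinant $\pm1$ version).** Around each $m\in\mathbf M$ draw a small arc $h_m$ (horocycle) in $\mathbf S$, all disjoint, and fix a local orientation $o_m$ near $m$ (as given by a planar drawing of $\mathbf S$ with crosscaps). For an end at $m$ of an arc or boundary segment $\tau$ of $T$, $v_{m,\tau}=h_m\cap\tau$, and $v^{+}_{m,\tau}$, $v^-_{m,\tau}$ are points of $h_m$ just clockwise, resp. counterclockwise, of $v_{m,\tau}$ (w.r.t. $o_m$). - Type 1: move along $h_m$ inside the corner at $m$ of a triangle of $T$, from $\tau$ to $\tau'$, where $\sigma$ is the third side of the triangle; matrix $\begin{bmatrix}1&0\\ \pm\frac{x_\sigma}{x_\tau x_{\tau'}}&1\end{bmatrix}$, sign $+$ if clockwise and $-$ otherwise. - Type 2: cross $\tau\in T$ along $h_m$.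 With $b=b_T(\mathcal L_T,\tau)$ at the point $v_{m,\tau}$ with orientation $o_m$: the matrix is $\operatorname{diag}(y_\tau^{ -1/2},y_\tau^{1/2})$ if (clockwise and $b=1$) or (counterclockwise and $b=-1$), and $\operatorname{diag}(y_\tau^{1/2},y_\tau^{ -1/2})$ otherwise. - Type 3: follow a path parallel to $\tau$ from a point near one end, at $m$, to a point near its other end, at $m'$, not crossing $\tau$, when transport along $\tau$ carries $o_m$ to $o_{m'}$ (so the path goes from $v^\pm_{m,\tau}$ to $v^\mp_{m',\tau}$); matrix $\begin{bmatrix}0&x_\tau\\-\frac1{x_\tau}&0\end{bmatrix}$ if $\tau$ is seen on the right at the start, and $\begin{bmatrix}0&-x_\tau\\ \frac1{x_\tau}&0\end{bmatrix}$ otherwise. - Type $3'$: the same when transport along $\tau$ reverses orientation, i.e. the path goes through the crosscap, from $v^{\pm}_{m,\tau}$ to $v^{\pm}_{m',\tau}$; matrix $\begin{bmatrix}0&x_\tau\\ \frac1{x_\tau}&0\end{bmatrix}$ if $\tau$ is seen on the right at the start and $\begin{bmatrix}0&-x_\tau\\-\frac1{x_\tau}&0\end{bmatrix}$ otherwise. **$\overline\chi$.** An $M$-path for a closed curve $\beta$ is a closed path $\rho$ that is a concatenation of elementary steps $\rho_1,\dots,\rho_t$ (in this order), is isotopic to $\beta$, and whose intersections with $T$ are in bijection with those of $\beta$. Put $\overline M(\rho)=\overline M(\rho_t)\cdots\overline M(\rho_1)$, the product of the matrices above, and $\overline\chi_{\beta,\mathcal L_T}=|\operatorname{tr}\overline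 M(\rho)|$, which does not depend on $\rho$; here $|f|$ is whichever of $f,-f$ has positive coefficients. -}

module Defs where

open import Data.Bool.Base using (Bool; true; false; not; if_then_else_)
open import Data.Fin.Base using (Fin; zero; suc; join)
open import Data.Integer.Base using (ℤ; 0ℤ; 1ℤ; -1ℤ; _◃_)
import Data.Integer.Base as ℤ
import Data.Integer.Properties as ℤ
open import Data.List.Base using (List; []; _∷_; _++_; map; cartesianProductWith)
open import Data.Nat.Base using (ℕ; suc; _≤_)
import Data.Nat.Base as ℕ
open import Data.Product.Base using (Σ; _×_; _,_; ∃-syntax; proj₁; proj₂)
open import Data.Sign.Base using (Sign; opposite) renaming (+ to ⊕; - to ⊖; _*_ to _·_)
open import Data.Sum.Base using (_⊎_; inj₁; inj₂; map₁)
open import Data.Vec.Base using (Vec; replicate; zipWith; _[_]≔_)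
open import Data.Vec.Properties using (≡-dec)
open import Function.Base using (_∘_)
open import Function.Bundles using (_↔_; Inverse)
open import Relation.Binary.Construct.Closure.Equivalence using (EqClosure)
open import Relation.Binary.Construct.Closure.ReflexiveTransitive
  using (Star; ε; _◅_; _◅◅_; reverse)
open import Relation.Binary.PropositionalEquality using (_≡_)
open import Relation.Nullary using (does)

------------------------------------------------------------------------
-- Integer Laurent polynomials in n variables

-- A formal sum of terms c·zᵉ; terms with equal exponents may repeat, so
-- polynomials are compared with _≈_ and not with _≡_.
Laurent : ℕ → Set
Laurent n = List (ℤ × Vec ℤ n)

module _ {n : ℕ} where

  coeff : Laurent n → Vec ℤ n → ℤ
  coeff []            e = 0ℤ
  coeff ((c , d) ∷ f) e =
    (if does (≡-dec ℤ._≟_ d e) then c else 0ℤ) ℤ.+ coeff f e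

  infix 4 _≈_
  _≈_ : Laurent n → Laurent n → Set
  f ≈ g = ∀ e → coeff f e ≡ coeff g e

  infixl 6 _+_ _-_
  infixl 7 _*_
  infix  8 -_

  _+_ : Laurent n → Laurent n → Laurent n
  _+_ = _++_

  -_ : Laurent n → Laurent n
  -_ = map (λ (c , d) → ℤ.- c , d)

  _-_ : Laurent n → Laurent n → Laurent n
  f - g = f + (- g)

  _*_ : Laurent n → Laurent n → Laurent n
  _*_ = cartesianProductWith
    (λ (c , d) (c′ , d′) → c ℤ.* c′ , zipWith ℤ._+_ d d′)

  const : ℤ → Laurent n
  const c = (c , replicate n 0ℤ) ∷ []

  power : Fin n → ℤ → Laurent n
  power i k = (1ℤ , replicate n 0ℤ [ i ]≔ k) ∷ []

  -- g is |f|: whichever of f and - f has positive coefficients.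
  _IsAbsOf_ : Laurent n → Laurent n → Set
  g IsAbsOf f = (g ≈ f ⊎ g ≈ - f) × (∀ e → 0ℤ ℤ.≤ coeff g e)

  record Matrix : Set where
    constructor ⟦_,_∣_,_⟧
    field
      m₁₁ m₁₂ m₂₁ m₂₂ : Laurent n

  open Matrix

  infixl 7 _⊗_
  _⊗_ : Matrix → Matrix → Matrix
  A ⊗ B = ⟦ m₁₁ A * m₁₁ B + m₁₂ A * m₂₁ B , m₁₁ A * m₁₂ B + m₁₂ A * m₂₂ B
          ∣ m₂₁ A * m₁₁ B + m₂₂ A * m₂₁ B , m₂₁ A * m₁₂ B + m₂₂ A * m₂₂ B ⟧

  𝟙 : Matrix
  𝟙 = ⟦ const 1ℤ , const 0ℤ ∣ const 0ℤ , const 1ℤ ⟧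

  trace : Matrix → Laurent n
  trace A = m₁₁ A + m₂₂ A

------------------------------------------------------------------------
-- Triangulated marked surfaces

-- A marked surface with an ideal triangulation, as the gluing of the
-- triangles into which the arcs cut it.  Every triangle carries a
-- reference orientation, and its sides are numbered counterclockwise
-- for it.
record Triangulation : Set where
  field
    #triangles #arcs #segments : ℕ

  Triangle = Fin #triangles
  Arc      = Fin #arcs
  Segment  = Fin #segments         -- boundary segments
  Edge     = Arc ⊎ Segment
  Side     = Triangle × Fin 3

  field
    -- An arc is two sides glued together, a boundary segment is one side.
    gluing : ((Arc × Bool) ⊎ Segment) ↔ Side
    -- ⊕ if the reference orientations of the triangles on the two sides
    -- of the arc agree along it, ⊖ otherwise.
    twist  : Arc → Sign

  arcSide : Arc → Bool → Side
  arcSide τ s = Inverse.to gluing (inj₁ (τ , s))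

  segmentSide : Segment → Side
  segmentSide = Inverse.to gluing ∘ inj₂

  edge : Side → Edge
  edge = map₁ proj₁ ∘ Inverse.from gluing

open Triangulation

next prev : Fin 3 → Fin 3
next zero             = suc zero
next (suc zero)       = suc (suc zero)
next (suc (suc zero)) = zero
prev = next ∘ next

-- The ends of a side, when running counterclockwise round its triangle.
data End : Set where
  start finish : End

other : End → End
other start  = finish
other finish = start

-- In a coherently oriented gluing, adjacent triangles run along their
-- common arc in opposite directions.
acrossEnd : Sign → End → End
acrossEnd ⊕ e = other e
acrossEnd ⊖ e = e

-- The side that meets side i at the given end of i.
adjacent : Fin 3 → End → Fin 3
adjacent i start  = prev i
adjacent i finish = next i

pivoted : ∀ {n} → (Fin n × Fin 3) × End → (Fin n × Fin 3) × End
pivoted ((t , i) , e) = (t , adjacent i e) , other e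

slid : ∀ {n} → (Fin n × Fin 3) × End → (Fin n × Fin 3) × End
slid (h , e) = h , other e

module _ (T : Triangulation) where

  -- A directed crossing of an arc, from one triangle into another.
  data Crossing : Triangle T → Triangle T → Set where
    cross : ∀ τ s → Crossing (proj₁ (arcSide T τ s)) (proj₁ (arcSide T τ (not s)))

  -- Triangles are discs, so a curve transverse to the arcs is determined
  -- up to isotopy preserving its crossings by the sequence of crossings.
  Walk : Triangle T → Triangle T → Set
  Walk = Star Crossing

  record ClosedCurve : Set where
    constructor closed
    field
      {base} : Triangle T
      walk   : Walk base base

  -- The flag (τ , e), where m is the vertex at the end e of the side τ of a
  -- triangle, stands for the point of h_m lying in that triangle next to τ.
  -- For the reference orientation it is v⁻ if e is the start of τ, and v⁺
  -- if e is its finish.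
  Flag : Set
  Flag = Side T × End

  -- Steps along the horocycle: of type 1 (pivot) and type 2 (hop).
  data Around : Flag → Flag → Set where
    pivot : ∀ f → Around f (pivoted f)
    hop   : ∀ τ s e → Around (arcSide T τ s , e)
                             (arcSide T τ (not s) , acrossEnd (twist T τ) e)

  -- Steps of types 3 and 3′ are both slides: the path stays in a triangle,
  -- and the type depends on the local orientations chosen at the vertices.
  data Step : Flag → Flag → Set where
    around : ∀ {f g} → Around f g → Step f g
    slide  : ∀ f → Step f (slid f)

module _ {T : Triangulation} where

  backward : ∀ {t u} → Crossing T t u → Crossing T u t
  backward (cross τ false) = cross τ true
  backward (cross τ true)  = cross τ false

  length : ∀ {t u} → Walk T t u → ℕ
  length ε       = 0
  length (_ ◅ w) = suc (length w)

  crossings : ClosedCurve T → ℕ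
  crossings (closed w) = length w

  -- Isotopy of closed (not necessarily simple) curves, through curves that
  -- may cross themselves and in which neither a base point nor a direction
  -- is distinguished.  The only change of the crossings with T is the
  -- creation or removal of a bigon with an arc.
  data Move : ClosedCurve T → ClosedCurve T → Set where
    bigon  : ∀ {t u v} (p : Walk T t u) (c : Crossing T u v) (q : Walk T u t) →
             Move (closed (p ◅◅ c ◅ backward c ◅ q)) (closed (p ◅◅ q))
    rebase : ∀ {t u} (p : Walk T t u) (q : Walk T u t) →
             Move (closed (p ◅◅ q)) (closed (q ◅◅ p))
    invert : ∀ {t} (w : Walk T t t) →
             Move (closed w) (closed (reverse backward w))

  infix 4 _≃_
  _≃_ : ClosedCurve T → ClosedCurve T → Set
  _≃_ = EqClosure Move

  Minimal : ClosedCurve T → Set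
  Minimal β = ∀ γ → γ ≃ β → crossings β ≤ crossings γ

  -- Transport of a local orientation, relative to the reference ones.
  transport : ∀ {t u} → Walk T t u → Sign
  transport ε               = ⊕
  transport (cross τ _ ◅ w) = twist T τ · transport w

  OneSided : ClosedCurve T → Set
  OneSided (closed w) = transport w ≡ ⊖

  infix 9 _²
  _² : ClosedCurve T → ClosedCurve T
  closed w ² = closed (w ◅◅ w)

  shadow : ∀ {f g} → Star (Step T) f g → Walk T (proj₁ (proj₁ f)) (proj₁ (proj₁ g))
  shadow ε                        = ε
  shadow (around (pivot _)   ◅ ρ) = shadow ρ
  shadow (around (hop τ s _) ◅ ρ) = cross τ s ◅ shadow ρ
  shadow (slide _            ◅ ρ) = shadow ρ

  -- An M-path for β: it is isotopic to β and has as many intersections with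
  -- T as β has when drawn with the minimal number of them.
  record MPath (β : ClosedCurve T) : Set where
    field
      {origin} : Flag T
      path     : Star (Step T) origin origin
      isotopic : closed (shadow path) ≃ β
      minimal  : Minimal (closed (shadow path))

-- The direction in which L_τ turns at both ends when it runs along τ
-- towards them.
data Turn : Set where
  clockwise counterclockwise : Turn

orient : Sign → Turn → Turn
orient ⊕ r                = r
orient ⊖ clockwise        = counterclockwise
orient ⊖ counterclockwise = clockwise

data Hand : Set where
  left right : Hand

mirror : Hand → Hand
mirror left  = right
mirror right = left

-- The hand on which a curve that has crossed τ, runs along it and turns
-- at the end has the endpoint of τ: a curve turning clockwise moves away
-- from the endpoint ahead of it to its right.
endpoint : Turn → Hand
endpoint clockwise        = left
endpoint counterclockwise = right

-- Contribution to the shear coordinate of a segment crossing a side, τ and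
-- a side, with the common endpoints of the first side and τ, and of τ and
-- the last side, on the given hands.
shear : Hand → Hand → ℤ
shear right left  = 1ℤ     -- S-intersection
shear left  right = -1ℤ    -- Z-intersection
shear _     _     = 0ℤ

-- The same rule holds at both ends of L_τ, the first end being seen in
-- reverse; this also covers the one-sided L_τ, which near τ is a segment
-- of the same shape.
turnShear : Turn → ℤ
turnShear r = shear (mirror (endpoint r)) (endpoint r)

module _ (T : Triangulation) where

  Connected : Set
  Connected = ∀ t u → Walk T t u

  -- Going round any vertex one reaches the boundary, i.e. every marked
  -- point lies on the boundary.
  Unpunctured : Set
  Unpunctured = ∀ f → ∃[ d ] ∃[ e ] Star (Around T) f (segmentSide T d , e)

  Orientable : Set
  Orientable = Σ (Triangle T → Sign) λ ω → ∀ τ →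
    ω (proj₁ (arcSide T τ true)) ≡ twist T τ · ω (proj₁ (arcSide T τ false))

  -- The local orientations o_m.  A vertex is a class of flags under pivot
  -- and hop; o f compares o_m with the reference orientation of the
  -- triangle of f.
  record VertexOrientation : Set where
    field
      o       : Flag T → Sign
      o-pivot : ∀ f → o (pivoted f) ≡ o f
      o-hop   : ∀ τ s e → o (arcSide T τ (not s) , acrossEnd (twist T τ) e)
                        ≡ twist T τ · o (arcSide T τ s , e)

  -- L_τ is given by its turn for the reference orientation of the triangle
  -- at arcSide τ false, transported along τ.
  PrincipalLamination : Set
  PrincipalLamination = Arc T → Turn

  -- b_T at the side (τ , s), for the orientation which is ω times the
  -- reference orientation of its triangle.
  b : PrincipalLamination → Arc T → Bool → Sign → ℤ
  b L τ false ω = turnShear (orient ω (L τ))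
  b L τ true  ω = turnShear (orient (twist T τ · ω) (L τ))

------------------------------------------------------------------------
-- Matrices of elementary steps

-- One variable for each edge (x_τ) and one for each arc (y_τ^{1/2}).
#variables : Triangulation → ℕ
#variables T = (#arcs T ℕ.+ #segments T) ℕ.+ #arcs T

Poly : Triangulation → Set
Poly T = Laurent (#variables T)

module _ (T : Triangulation) where

  -- xᵏ σ k is x_σ^k
  xᵏ : Side T → ℤ → Poly T
  xᵏ σ = power (join _ (#arcs T) (inj₁ (join (#arcs T) _ (edge T σ))))

  -- y½ᵏ τ k is y_τ^{k/2}
  y½ᵏ : Arc T → ℤ → Poly T
  y½ᵏ τ = power (join (#arcs T ℕ.+ #segments T) _ (inj₂ τ))

  x x⁻¹ : Side T → Poly T
  x   σ = xᵏ σ 1ℤ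
  x⁻¹ σ = xᵏ σ -1ℤ

  StepMatrix : Set
  StepMatrix = Matrix {#variables T}

  -- σ , τ and τ′ are the third side, the side left and the side reached.
  pivotMatrix : Sign → (σ τ τ′ : Side T) → StepMatrix
  pivotMatrix s σ τ τ′ =
    ⟦ const 1ℤ                              , const 0ℤ
    ∣ const (s ◃ 1) * x σ * x⁻¹ τ * x⁻¹ τ′  , const 1ℤ ⟧

  -- diag (y^{-k/2} , y^{k/2}), with k = b for a clockwise step and k = - b
  -- for a counterclockwise one.
  hopMatrix : Arc T → ℤ → StepMatrix
  hopMatrix τ k = ⟦ y½ᵏ τ (ℤ.- k) , const 0ℤ ∣ const 0ℤ , y½ᵏ τ k ⟧

  -- The first argument is ⊕ for type 3 and ⊖ for type 3′, the second is ⊖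
  -- if τ is on the right and ⊕ if it is on the left.
  slideMatrix : Sign → Sign → Side T → StepMatrix
  slideMatrix ⊕ ⊖ τ = ⟦ const 0ℤ , x τ   ∣ - x⁻¹ τ , const 0ℤ ⟧
  slideMatrix ⊕ ⊕ τ = ⟦ const 0ℤ , - x τ ∣ x⁻¹ τ   , const 0ℤ ⟧
  slideMatrix ⊖ ⊖ τ = ⟦ const 0ℤ , x τ   ∣ x⁻¹ τ   , const 0ℤ ⟧
  slideMatrix ⊖ ⊕ τ = ⟦ const 0ℤ , - x τ ∣ - x⁻¹ τ , const 0ℤ ⟧

module _ {T : Triangulation} (O : VertexOrientation T) (L : PrincipalLamination T) where
  open VertexOrientation O

  -- The flag f is the point v^s of its horocycle with respect to o_m, where
  -- s = position f.  So, for o_m: pivoting from f is clockwise iff f is v⁺,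
  -- hopping from f is clockwise iff f is v⁻, and sliding from f has τ on
  -- the right iff f is v⁻.
  position : Flag T → Sign
  position f@(_ , start)  = ⊖ · o f
  position f@(_ , finish) = o f

  stepMatrix : ∀ {f g} → Step T f g → StepMatrix T
  stepMatrix (around (pivot f@((t , i) , e))) =
    pivotMatrix T (position f) (t , adjacent i (other e)) (t , i) (t , adjacent i e)
  stepMatrix (around (hop τ s e)) =
    hopMatrix T τ ((opposite (position f) ◃ 1) ℤ.* b T L τ s (o f))
    where f = arcSide T τ s , e
  stepMatrix (slide f@(h , _)) = slideMatrix T (o f · o (slid f)) (position f) h

  pathMatrix : ∀ {f g} → Star (Step T) f g → StepMatrix T
  pathMatrix ε       = 𝟙
  pathMatrix (s ◅ ρ) = pathMatrix ρ ⊗ stepMatrix s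

  -- g is χ̄_{β,L}, computed from some M-path for β.
  IsChi : ClosedCurve T → Poly T → Set
  IsChi β g = Σ (MPath β) λ ρ → g IsAbsOf trace (pathMatrix (MPath.path ρ))

{-# OPTIONS --safe #-}

-- For a one-sided α the product M of the step matrices has determinant -1,
-- so tr (M²) = (tr M)² + 2 by Cayley–Hamilton; it remains to see that |tr M|
-- depends on the isotopy class of the path only.  In suitable coordinates at
-- the flags, built from the λ-lengths x, the steps inside a triangle become
-- ±1 and each crossing of an arc becomes one matrix, inverse up to sign to
-- that of the opposite crossing and of determinant the twist of the arc.
-- The trace up to sign is thus a function of the sequence of crossings which
-- is unchanged by removing bigons, by cyclic shifts and by reversal.  The sign
-- of χ̄ for α² is found by setting all variables to 1.

module Submission where

open import Algebra.Bundles using (CommutativeRing)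
import Algebra.Properties.Ring
import Algebra.Solver.Ring
open import Algebra.Solver.Ring.AlmostCommutativeRing
  using (_-Raw-AlmostCommutative⟶_; fromCommutativeRing)
open import Data.Bool.Base using (Bool; true; false; not; if_then_else_)
open import Data.Bool.Properties using (not-involutive)
open import Data.Fin.Base using (Fin; zero; suc; join)
open import Data.Integer.Base using (ℤ; +_; 0ℤ; 1ℤ; -1ℤ; _◃_; +-*-rawRing)
  renaming (_+_ to _+ᶻ_; _*_ to _*ᶻ_; -_ to -ᶻ_; _≤_ to _≤ᶻ_)
import Data.Integer.Properties as ℤ
open import Data.Integer.Tactic.RingSolver using (solve-∀)
open import Data.List.Base using (List; []; _∷_; _++_; map; filter; length)
import Data.List.Properties as List
open import Data.Maybe.Base using (Maybe; nothing; just)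
open import Data.Nat.Base as ℕ using (ℕ; zero; suc; s≤s)
import Data.Nat.Properties as ℕ
open import Data.Product.Base using (_×_; _,_; ∃-syntax; proj₁)
open import Data.Sign.Base using (Sign; opposite) renaming (+ to ⊕; - to ⊖; _*_ to _·_)
import Data.Sign.Properties as Sign
open import Data.Sum.Base using (_⊎_; inj₁; inj₂; map₁)
open import Data.Vec.Base as Vec using (Vec; []; _∷_; replicate; zipWith; _[_]≔_)
import Data.Vec.Properties as Vec
open import Function.Bundles using (Inverse; _⇔_; mk⇔)
open import Level using (0ℓ)
open import Relation.Binary.Bundles using (Setoid)
open import Relation.Binary.Construct.Closure.Equivalence using (gfold)
open import Relation.Binary.Construct.Closure.ReflexiveTransitive
  using (Star; ε; _◅_; _◅◅_; reverse; revApp)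
open import Relation.Binary.PropositionalEquality as ≡ using (_≡_)
import Relation.Binary.Reasoning.Setoid as SetoidReasoning
open import Relation.Binary.Structures using (IsEquivalence)
open import Relation.Nullary using (¬_; does; yes; no; contradiction)
open import Relation.Nullary.Decidable using (¬?; dec-false; does-⇔)

-- 2 × 2 matrices up to sign

-- Signs are not preserved by isotopy of paths: in the chosen coordinates every slide acts as -1, so
-- the contractible loop along the three sides of a triangle has matrix -I. Matrices are therefore
-- compared modulo ±I throughout. This loses nothing for α, whose trace enters only squared, and
-- leaves one sign for α² to be settled by positivity. The coordinates come from reading λ-lengths
-- as determinants: a triangle with three λ-lengths is a triple of plane vectors at its vertices,
-- and the linear relation between three vectors of a plane is exactly what a pivot matrix encodes.
-- The local orientations at the marked points enter a crossing several times and cancel, so that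
-- only the twist of the arc survives. The M-paths for α and for α² are chosen independently, and
-- the second need not be the first traversed twice. Hence the relation is proved for a quantity
-- attached to sequences of crossings, where doubling is literal concatenation, and each M-path is
-- compared with that quantity separately.

module Matrices (R : CommutativeRing 0ℓ 0ℓ)
  (ι : +-*-rawRing -Raw-AlmostCommutative⟶ fromCommutativeRing R) where

  open CommutativeRing R
  open Algebra.Properties.Ring ring using (-1*x≈-x; -‿involutive)
  open _-Raw-AlmostCommutative⟶_ ι using (⟦_⟧; 0-homo)

  integer≟ : ∀ a b → Maybe (⟦ a ⟧ ≈ ⟦ b ⟧)
  integer≟ a b with a ℤ.≟ b
  ... | yes a≡b = just (reflexive (≡.cong ⟦_⟧ a≡b))
  ... | no  _   = nothing

  open Algebra.Solver.Ring +-*-rawRing (fromCommutativeRing R) ι integer≟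
    using (solve; con; _:+_; _:*_; :-_; _:-_; _:=_)

  sgn : Sign → Carrier
  sgn ⊕ = 1#
  sgn ⊖ = - 1#

  sgn-* : ∀ s t → sgn (s · t) ≈ sgn s * sgn t
  sgn-* ⊕ t = sym (*-identityˡ (sgn t))
  sgn-* ⊖ ⊕ = sym (*-identityʳ (- 1#))
  sgn-* ⊖ ⊖ = sym (trans (-1*x≈-x (- 1#)) (-‿involutive 1#))

  sgn² : ∀ s → sgn s * sgn s ≈ 1#
  sgn² s = trans (sym (sgn-* s s)) (reflexive (≡.cong sgn (Sign.s*s≡+ s)))

  sgn-opposite : ∀ s → sgn (opposite s) ≈ - sgn s
  sgn-opposite ⊕ = refl
  sgn-opposite ⊖ = sym (-‿involutive 1#)

  infix 4 _≈±_
  _≈±_ : Carrier → Carrier → Set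
  a ≈± b = ∃[ s ] a ≈ sgn s * b

  scaled-trans : ∀ s t {a b c} → a ≈ sgn s * b → b ≈ sgn t * c → a ≈ sgn (s · t) * c
  scaled-trans s t {a} {b} {c} p q = begin
    a                        ≈⟨ p ⟩
    sgn s * b                ≈⟨ *-congˡ q ⟩
    sgn s * (sgn t * c)      ≈⟨ *-assoc (sgn s) (sgn t) c ⟨
    (sgn s * sgn t) * c      ≈⟨ *-congʳ (sgn-* s t) ⟨
    sgn (s · t) * c          ∎
    where open SetoidReasoning setoid

  scaled-sym : ∀ s {a b} → a ≈ sgn s * b → b ≈ sgn s * a
  scaled-sym s {a} {b} p = begin
    b                      ≈⟨ *-identityˡ b ⟨
    1# * b                 ≈⟨ *-congʳ (sgn² s) ⟨
    (sgn s * sgn s) * b    ≈⟨ *-assoc (sgn s) (sgn s) b ⟩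
    sgn s * (sgn s * b)    ≈⟨ *-congˡ p ⟨
    sgn s * a              ∎
    where open SetoidReasoning setoid

  ≈±-sym : ∀ {a b} → a ≈± b → b ≈± a
  ≈±-sym (s , p) = s , scaled-sym s p

  ≈±-trans : ∀ {a b c} → a ≈± b → b ≈± c → a ≈± c
  ≈±-trans (s , p) (t , q) = s · t , scaled-trans s t p q

  ≈⇒≈± : ∀ {a b} → a ≈ b → a ≈± b
  ≈⇒≈± {b = b} p = ⊕ , trans p (sym (*-identityˡ b))

  ≈±-isEquivalence : IsEquivalence _≈±_
  ≈±-isEquivalence = record { refl = ≈⇒≈± refl ; sym = ≈±-sym ; trans = ≈±-trans }

  ≈±-square : ∀ {a b} → a ≈± b → a * a ≈ b * b
  ≈±-square {a} {b} (s , p) = begin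
    a * a                        ≈⟨ *-cong p p ⟩
    (sgn s * b) * (sgn s * b)    ≈⟨ solve 2 (λ s b → (s :* b) :* (s :* b) := (s :* s) :* (b :* b)) refl (sgn s) b ⟩
    (sgn s * sgn s) * (b * b)    ≈⟨ *-congʳ (sgn² s) ⟩
    1# * (b * b)                 ≈⟨ *-identityˡ (b * b) ⟩
    b * b                        ∎
    where open SetoidReasoning setoid

  record Mat : Set where
    constructor mat
    field
      m₁₁ m₁₂ m₂₁ m₂₂ : Carrier

  open Mat public

  infixl 7 _⊛_
  _⊛_ : Mat → Mat → Mat
  A ⊛ B = mat (m₁₁ A * m₁₁ B + m₁₂ A * m₂₁ B) (m₁₁ A * m₁₂ B + m₁₂ A * m₂₂ B)
              (m₂₁ A * m₁₁ B + m₂₂ A * m₂₁ B) (m₂₁ A * m₁₂ B + m₂₂ A * m₂₂ B)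

  I : Mat
  I = mat 1# 0# 0# 1#

  adj : Mat → Mat
  adj A = mat (m₂₂ A) (- m₁₂ A) (- m₂₁ A) (m₁₁ A)

  det tr : Mat → Carrier
  det A = m₁₁ A * m₂₂ A - m₁₂ A * m₂₁ A
  tr A = m₁₁ A + m₂₂ A

  infix 4 _∼_
  -- One sign serves all four entries, as in the quotient of matrices by ±I. A separate sign for
  -- each entry would not be respected by products or traces.
  record _∼_ (A B : Mat) : Set where
    constructor scaled
    field
      sign : Sign
      eq₁₁ : m₁₁ A ≈ sgn sign * m₁₁ B
      eq₁₂ : m₁₂ A ≈ sgn sign * m₁₂ B
      eq₂₁ : m₂₁ A ≈ sgn sign * m₂₁ B
      eq₂₂ : m₂₂ A ≈ sgn sign * m₂₂ B

  ∼-exact : ∀ {A B} → m₁₁ A ≈ m₁₁ B → m₁₂ A ≈ m₁₂ B → m₂₁ A ≈ m₂₁ B → m₂₂ A ≈ m₂₂ B → A ∼ B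
  ∼-exact p q r s = scaled ⊕ (unit p) (unit q) (unit r) (unit s)
    where
    unit : ∀ {a b} → a ≈ b → a ≈ 1# * b
    unit {b = b} p = trans p (sym (*-identityˡ b))

  ∼-refl : ∀ {A} → A ∼ A
  ∼-refl = ∼-exact refl refl refl refl

  ∼-sym : ∀ {A B} → A ∼ B → B ∼ A
  ∼-sym (scaled s p q r t) = scaled s (scaled-sym s p) (scaled-sym s q) (scaled-sym s r) (scaled-sym s t)

  ∼-trans : ∀ {A B C} → A ∼ B → B ∼ C → A ∼ C
  ∼-trans (scaled s p q r t) (scaled s′ p′ q′ r′ t′) = scaled (s · s′)
    (scaled-trans s s′ p p′) (scaled-trans s s′ q q′) (scaled-trans s s′ r r′) (scaled-trans s s′ t t′)

  ∼-setoid : Setoid 0ℓ 0ℓ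
  ∼-setoid = record
    { _≈_ = _∼_
    ; isEquivalence = record { refl = ∼-refl ; sym = ∼-sym ; trans = ∼-trans }
    }

  -- An entry of a product is a sum, and `≈±` is not compatible with sums. It works here because
  -- both summands carry the same sign `s · t`.
  scaled-row : ∀ s t {a a′ b b′ c c′ d d′} →
               a ≈ sgn s * a′ → b ≈ sgn t * b′ → c ≈ sgn s * c′ → d ≈ sgn t * d′ →
               a * b + c * d ≈ sgn (s · t) * (a′ * b′ + c′ * d′)
  scaled-row s t {a} {a′} {b} {b′} {c} {c′} {d} {d′} p q r u = begin
    a * b + c * d
      ≈⟨ +-cong (*-cong p q) (*-cong r u) ⟩
    (sgn s * a′) * (sgn t * b′) + (sgn s * c′) * (sgn t * d′)
      ≈⟨ solve 6 (λ s t a b c d → (s :* a) :* (t :* b) :+ (s :* c) :* (t :* d)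
                                := (s :* t) :* (a :* b :+ c :* d)) refl (sgn s) (sgn t) a′ b′ c′ d′ ⟩
    (sgn s * sgn t) * (a′ * b′ + c′ * d′)
      ≈⟨ *-congʳ (sgn-* s t) ⟨
    sgn (s · t) * (a′ * b′ + c′ * d′) ∎
    where open SetoidReasoning setoid

  ⊛-cong : ∀ {A A′ B B′} → A ∼ A′ → B ∼ B′ → A ⊛ B ∼ A′ ⊛ B′
  ⊛-cong (scaled s p q r u) (scaled t p′ q′ r′ u′) = scaled (s · t)
    (scaled-row s t p p′ q r′) (scaled-row s t p q′ q u′)
    (scaled-row s t r p′ u r′) (scaled-row s t r q′ u u′)

  ⊛-congˡ : ∀ {A B B′} → B ∼ B′ → A ⊛ B ∼ A ⊛ B′
  ⊛-congˡ = ⊛-cong ∼-refl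

  ⊛-congʳ : ∀ {A A′ B} → A ∼ A′ → A ⊛ B ∼ A′ ⊛ B
  ⊛-congʳ p = ⊛-cong p ∼-refl

  ⊛-assoc : ∀ A B C → (A ⊛ B) ⊛ C ∼ A ⊛ (B ⊛ C)
  ⊛-assoc (mat a b c d) (mat e f g h) (mat i j k l) =
    ∼-exact (entry a b i k) (entry a b j l) (entry c d i k) (entry c d j l)
    where
    entry : ∀ a b i k → (a * e + b * g) * i + (a * f + b * h) * k ≈ a * (e * i + f * k) + b * (g * i + h * k)
    entry a b i k = solve 8 (λ a b e f g h i k →
      (a :* e :+ b :* g) :* i :+ (a :* f :+ b :* h) :* k := a :* (e :* i :+ f :* k) :+ b :* (g :* i :+ h :* k))
      refl a b e f g h i k

  1a+0b : ∀ a b → 1# * a + 0# * b ≈ a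
  1a+0b a b = trans (+-cong (*-identityˡ a) (zeroˡ b)) (+-identityʳ a)

  0a+1b : ∀ a b → 0# * a + 1# * b ≈ b
  0a+1b a b = trans (+-cong (zeroˡ a) (*-identityˡ b)) (+-identityˡ b)

  ⊛-identityˡ : ∀ A → I ⊛ A ∼ A
  ⊛-identityˡ (mat a b c d) = ∼-exact (1a+0b a c) (1a+0b b d) (0a+1b a c) (0a+1b b d)

  ⊛-identityʳ : ∀ A → A ⊛ I ∼ A
  ⊛-identityʳ (mat a b c d) = ∼-exact
    (trans (+-cong (*-comm a 1#) (*-comm b 0#)) (1a+0b a b))
    (trans (+-cong (*-comm a 0#) (*-comm b 1#)) (0a+1b a b))
    (trans (+-cong (*-comm c 1#) (*-comm d 0#)) (1a+0b c d))
    (trans (+-cong (*-comm c 0#) (*-comm d 1#)) (0a+1b c d))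

  det-⊛ : ∀ A B → det (A ⊛ B) ≈ det A * det B
  det-⊛ (mat a b c d) (mat e f g h) = solve 8 (λ a b c d e f g h →
    (a :* e :+ b :* g) :* (c :* f :+ d :* h) :- (a :* f :+ b :* h) :* (c :* e :+ d :* g)
    := (a :* d :- b :* c) :* (e :* h :- f :* g)) refl a b c d e f g h

  det-adj : ∀ A → det (adj A) ≈ det A
  det-adj (mat a b c d) =
    solve 4 (λ a b c d → d :* a :- (:- b) :* (:- c) := a :* d :- b :* c) refl a b c d

  -- The product is `det A` times `I`, so for determinant ±1 the adjugate is an inverse modulo sign,
  -- without any division in `R`.
  adj-inverseˡ : ∀ A s → det A ≈ sgn s → adj A ⊛ A ∼ I
  adj-inverseˡ (mat a b c d) s p = scaled s
    (trans (solve 4 (λ a b c d → d :* a :+ (:- b) :* c := a :* d :- b :* c) refl a b c d) diagonal)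
    (trans (solve 2 (λ b d → d :* b :+ (:- b) :* d := con 0ℤ) refl b d) off)
    (trans (solve 2 (λ a c → (:- c) :* a :+ a :* c := con 0ℤ) refl a c) off)
    (trans (solve 4 (λ a b c d → (:- c) :* b :+ a :* d := a :* d :- b :* c) refl a b c d) diagonal)
    where
    diagonal = trans p (sym (*-identityʳ (sgn s)))
    off = trans 0-homo (sym (zeroʳ (sgn s)))

  adj-inverseʳ : ∀ A s → det A ≈ sgn s → A ⊛ adj A ∼ I
  adj-inverseʳ (mat a b c d) s p = scaled s
    (trans (solve 4 (λ a b c d → a :* d :+ b :* (:- c) := a :* d :- b :* c) refl a b c d) diagonal)
    (trans (solve 2 (λ a b → a :* (:- b) :+ b :* a := con 0ℤ) refl a b) off)
    (trans (solve 2 (λ c d → c :* d :+ d :* (:- c) := con 0ℤ) refl c d) off)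
    (trans (solve 4 (λ a b c d → c :* (:- b) :+ d :* a := a :* d :- b :* c) refl a b c d) diagonal)
    where
    diagonal = trans p (sym (*-identityʳ (sgn s)))
    off = trans 0-homo (sym (zeroʳ (sgn s)))

  tr-cong : ∀ {A B} → A ∼ B → tr A ≈± tr B
  tr-cong {B = B} (scaled s p _ _ q) = s , trans (+-cong p q) (sym (distribˡ (sgn s) (m₁₁ B) (m₂₂ B)))

  tr-comm : ∀ A B → tr (A ⊛ B) ≈ tr (B ⊛ A)
  tr-comm (mat a b c d) (mat e f g h) = solve 8 (λ a b c d e f g h →
    (a :* e :+ b :* g) :+ (c :* f :+ d :* h) := (e :* a :+ f :* c) :+ (g :* b :+ h :* d))
    refl a b c d e f g h

  -- Cayley–Hamilton.
  tr-square : ∀ A → tr (A ⊛ A) ≈ tr A * tr A - (det A + det A)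
  tr-square (mat a b c d) = solve 4 (λ a b c d →
    (a :* a :+ b :* c) :+ (c :* b :+ d :* d)
    := (a :+ d) :* (a :+ d) :- ((a :* d :- b :* c) :+ (a :* d :- b :* c))) refl a b c d

  -- Inverses modulo sign are unique, so `B` is the adjugate, which merely exchanges the diagonal
  -- entries.
  tr-inverse : ∀ A B s → det A ≈ sgn s → B ⊛ A ∼ I → tr B ≈± tr A
  tr-inverse A B s p q = ≈±-trans (tr-cong B∼adjA) (≈⇒≈± (+-comm (m₂₂ A) (m₁₁ A)))
    where
    open SetoidReasoning ∼-setoid
    B∼adjA : B ∼ adj A
    B∼adjA = begin
      B                  ≈⟨ ⊛-identityʳ B ⟨
      B ⊛ I              ≈⟨ ⊛-congˡ (adj-inverseʳ A s p) ⟨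
      B ⊛ (A ⊛ adj A)    ≈⟨ ⊛-assoc B A (adj A) ⟨
      (B ⊛ A) ⊛ adj A    ≈⟨ ⊛-congʳ q ⟩
      I ⊛ adj A          ≈⟨ ⊛-identityˡ (adj A) ⟩
      adj A              ∎

-- Matrices of paths in a triangulated surface

module _ where
  open import Defs hiding (_≈_; _+_; _*_; _-_; -_; x; x⁻¹; length)

  -- The ring stays abstract so that identities are solved in opaque elements rather than in lists
  -- of terms. Of the variables only their invertibility is assumed; half-integer powers of y are
  -- hidden in the family `y`.
  module Holonomy (R : CommutativeRing 0ℓ 0ℓ)
    (ι : +-*-rawRing -Raw-AlmostCommutative⟶ fromCommutativeRing R)
    {T : Triangulation} (O : VertexOrientation T) (L : PrincipalLamination T)
    (xᵉ xᵉ⁻¹ : Triangulation.Edge T → CommutativeRing.Carrier R)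
    (xᵉ-inverse : ∀ η → CommutativeRing._≈_ R
      (CommutativeRing._*_ R (xᵉ η) (xᵉ⁻¹ η)) (CommutativeRing.1# R))
    (y : Triangulation.Arc T → ℤ → CommutativeRing.Carrier R)
    (y-inverse : ∀ τ k → CommutativeRing._≈_ R
      (CommutativeRing._*_ R (y τ k) (y τ (-ᶻ k))) (CommutativeRing.1# R))
    where

    open CommutativeRing R hiding (zero)
    open Triangulation T
    open Matrices R ι
    open VertexOrientation O
    open Algebra.Properties.Ring ring using (-1*x≈-x; -0#≈0#)
    open Algebra.Solver.Ring +-*-rawRing (fromCommutativeRing R) ι integer≟
      using (solve; con; _:+_; _:*_; :-_; _:-_; _:=_)
    open _-Raw-AlmostCommutative⟶_ ι using (0-homo)

    x x⁻¹ : Side → Carrier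
    x   σ = xᵉ (edge σ)
    x⁻¹ σ = xᵉ⁻¹ (edge σ)

    x-inverse : ∀ σ → x σ * x⁻¹ σ ≈ 1#
    x-inverse σ = xᵉ-inverse (edge σ)

    edge-arcSide : ∀ τ s → edge (arcSide τ s) ≡ inj₁ τ
    edge-arcSide τ s = ≡.cong (map₁ proj₁) (Inverse.strictlyInverseʳ gluing (inj₁ (τ , s)))

    edge-glued : ∀ τ s → edge (arcSide τ s) ≡ edge (arcSide τ (not s))
    edge-glued τ s = ≡.trans (edge-arcSide τ s) (≡.sym (edge-arcSide τ (not s)))

    pos : Flag T → Sign
    pos = position O L

    pos-pivoted : ∀ f → pos (pivoted f) ≡ opposite (pos f)
    pos-pivoted f@(_ , start)  = ≡.trans (o-pivot f) (≡.sym (Sign.opposite-involutive (o f)))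
    pos-pivoted f@(_ , finish) = ≡.cong opposite (o-pivot f)

    -- The factor `o f · o (slid f)` tells type 3 from type 3′: the former leads from v^± to v^∓,
    -- the latter from v^± to v^±.
    pos-slid : ∀ f → pos (slid f) ≡ opposite ((o f · o (slid f)) · pos f)
    pos-slid f@(_ , start)  = lemma (o f) (o (slid f))
      where
      lemma : ∀ a b → b ≡ opposite ((a · b) · opposite a)
      lemma ⊕ ⊕ = ≡.refl
      lemma ⊕ ⊖ = ≡.refl
      lemma ⊖ ⊕ = ≡.refl
      lemma ⊖ ⊖ = ≡.refl
    pos-slid f@(_ , finish) = lemma (o f) (o (slid f))
      where
      lemma : ∀ a b → opposite b ≡ opposite ((a · b) · a)
      lemma ⊕ ⊕ = ≡.refl
      lemma ⊕ ⊖ = ≡.refl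
      lemma ⊖ ⊕ = ≡.refl
      lemma ⊖ ⊖ = ≡.refl

    before after : Arc → Bool → End → Flag T
    before τ s e = arcSide τ s , e
    after  τ s e = arcSide τ (not s) , acrossEnd (twist τ) e

    -- A hop along the horocycle passes from one side of the arc to the other for the fixed
    -- orientation at the vertex. The twist alters either the end or the comparison `o`, never the
    -- outcome.
    pos-after : ∀ τ s e → pos (after τ s e) ≡ opposite (pos (before τ s e))
    pos-after τ s e with twist τ | o-hop τ s e
    pos-after τ s start  | ⊕ | p = ≡.trans p (≡.sym (Sign.opposite-involutive _))
    pos-after τ s finish | ⊕ | p = ≡.cong opposite p
    pos-after τ s start  | ⊖ | p = ≡.cong opposite p
    pos-after τ s finish | ⊖ | p = p

    -- Step matrices over an abstract ring

    pivotM : (f : Flag T) → Mat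
    pivotM f@((t , i) , e) = mat 1# 0#
      (sgn (pos f) * x (t , adjacent i (other e)) * x⁻¹ (t , i) * x⁻¹ (t , adjacent i e)) 1#

    hopM : Arc → ℤ → Mat
    hopM τ k = mat (y τ (-ᶻ k)) 0# 0# (y τ k)

    -- The four cases of types 3 and 3′ in one formula. Its determinant is `sgn s`, so -1 exactly
    -- for type 3′.
    slideM : Sign → Sign → Side → Mat
    slideM s p σ = mat 0# (sgn (opposite p) * x σ) (sgn (s · p) * x⁻¹ σ) 0#

    exponent : Arc → Bool → End → ℤ
    exponent τ s e = (opposite (pos (before τ s e)) ◃ 1) *ᶻ b T L τ s (o (before τ s e))

    stepM : ∀ {f g} → Step T f g → Mat
    stepM (around (pivot f))     = pivotM f
    stepM (around (hop τ s e))   = hopM τ (exponent τ s e)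
    stepM (slide f@(h , _))      = slideM (o f · o (slid f)) (pos f) h

    pathM : ∀ {f g} → Star (Step T) f g → Mat
    pathM ε       = I
    pathM (s ◅ ρ) = pathM ρ ⊛ stepM s

    -- Vectors of the plane at the vertices of t, chosen so that the determinant
    -- of two consecutive ones is the x of the side between them; vertex i is the
    -- start of side i.
    v₁ v₂ : Triangle → Fin 3 → Carrier
    v₁ t zero             = 1#
    v₁ t (suc zero)       = 0#
    v₁ t (suc (suc zero)) = - (x (t , suc zero) * x⁻¹ (t , zero))
    v₂ t zero             = 0#
    v₂ t (suc zero)       = x (t , zero)
    v₂ t (suc (suc zero)) = - x (t , suc (suc zero))

    tip : Fin 3 → End → Fin 3
    tip i start  = i
    tip i finish = next i

    -- The coordinates in which pivots and slides act trivially up to sign.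
    frame : Flag T → Mat
    frame f@((t , i) , e) = mat (v₁ t (tip i e)) (v₂ t (tip i e))
      (sgn (pos f) * x⁻¹ (t , i) * v₁ t (tip i (other e)))
      (sgn (pos f) * x⁻¹ (t , i) * v₂ t (tip i (other e)))

    module _ (t : Triangle) where
      open SetoidReasoning setoid hiding (start)

      private
        x₀ = x (t , zero)
        x₁ = x (t , suc zero)
        x₂ = x (t , suc (suc zero))
        x₀⁻¹ = x⁻¹ (t , zero)

      -- For plane vectors, det(b,c) a + det(c,a) b + det(a,b) c = 0. Each vertex vector is thus
      -- weighted by the λ-length of the opposite side; this is the first coordinate of that
      -- relation.
      ptolemy₁ : x₁ * v₁ t zero + x₂ * v₁ t (suc zero) + x₀ * v₁ t (suc (suc zero)) ≈ 0#
      ptolemy₁ = begin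
        x₁ * 1# + x₂ * 0# + x₀ * - (x₁ * x₀⁻¹)
          -- `1#` and `0#` are passed as variables because constants of the solver denote images of
          -- integers, which are only `≈` to them.
          ≈⟨ solve 6 (λ a b c c′ o z → a :* o :+ b :* z :+ c :* (:- (a :* c′)) := a :* (o :- c :* c′) :+ b :* z) refl x₁ x₂ x₀ x₀⁻¹ 1# 0# ⟩
        x₁ * (1# - x₀ * x₀⁻¹) + x₂ * 0#
          ≈⟨ +-cong (*-congˡ (+-congˡ (-‿cong (x-inverse (t , zero))))) (zeroʳ x₂) ⟩
        x₁ * (1# - 1#) + 0#
          ≈⟨ trans (+-identityʳ _) (*-congˡ (-‿inverseʳ 1#)) ⟩
        x₁ * 0#
          ≈⟨ zeroʳ x₁ ⟩
        0# ∎

      ptolemy₂ : x₁ * v₂ t zero + x₂ * v₂ t (suc zero) + x₀ * v₂ t (suc (suc zero)) ≈ 0#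
      ptolemy₂ = begin
        x₁ * 0# + x₂ * x₀ + x₀ * - x₂    ≈⟨ +-congʳ (+-congʳ (zeroʳ x₁)) ⟩
        0# + x₂ * x₀ + x₀ * - x₂         ≈⟨ +-congʳ (+-identityˡ _) ⟩
        x₂ * x₀ + x₀ * - x₂              ≈⟨ solve 2 (λ b c → b :* c :+ c :* (:- b) := con 0ℤ) refl x₂ x₀ ⟩
        _                                ≈⟨ 0-homo ⟩
        0# ∎

      det-vertices : ∀ i → v₁ t i * v₂ t (next i) - v₂ t i * v₁ t (next i) ≈ x (t , i)
      det-vertices zero = begin
        1# * x₀ - 0# * 0#              ≈⟨ +-cong (*-identityˡ x₀) (-‿cong (zeroˡ 0#)) ⟩
        x₀ - 0#                        ≈⟨ +-congˡ -0#≈0# ⟩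
        x₀ + 0#                        ≈⟨ +-identityʳ x₀ ⟩
        x₀                             ∎
      det-vertices (suc zero) = begin
        0# * - x₂ - x₀ * - (x₁ * x₀⁻¹)   ≈⟨ +-congʳ (zeroˡ (- x₂)) ⟩
        0# - x₀ * - (x₁ * x₀⁻¹)          ≈⟨ +-identityˡ _ ⟩
        - (x₀ * - (x₁ * x₀⁻¹))           ≈⟨ solve 3 (λ a b c → :- (a :* (:- (b :* c))) := (a :* c) :* b) refl x₀ x₁ x₀⁻¹ ⟩
        (x₀ * x₀⁻¹) * x₁                 ≈⟨ *-congʳ (x-inverse (t , zero)) ⟩
        1# * x₁                          ≈⟨ *-identityˡ x₁ ⟩
        x₁                               ∎
      det-vertices (suc (suc zero)) = begin
        - (x₁ * x₀⁻¹) * 0# - (- x₂) * 1#   ≈⟨ +-congʳ (zeroʳ _) ⟩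
        0# - (- x₂) * 1#                   ≈⟨ +-identityˡ _ ⟩
        - ((- x₂) * 1#)                    ≈⟨ -‿cong (*-identityʳ _) ⟩
        - (- x₂)                           ≈⟨ solve 1 (λ a → :- (:- a) := a) refl x₂ ⟩
        x₂                                 ∎

      -- The same relation as seen from a flag: the six cases permute the three summands.
      ptolemy : (v : Fin 3 → Carrier) →
                x₁ * v zero + x₂ * v (suc zero) + x₀ * v (suc (suc zero)) ≈ 0# →
                ∀ i e → x (t , adjacent i (other e)) * v (tip i e)
                      + x (t , adjacent i e) * v (tip i (other e))
                      + x (t , i) * v (tip (adjacent i e) e) ≈ 0#
      ptolemy v p i e = trans (permuted i e) p
        where
        a₁ = x₁ * v zero
        a₂ = x₂ * v (suc zero)
        a₀ = x₀ * v (suc (suc zero))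
        permuted : ∀ i e → x (t , adjacent i (other e)) * v (tip i e)
                         + x (t , adjacent i e) * v (tip i (other e))
                         + x (t , i) * v (tip (adjacent i e) e)
                         ≈ x₁ * v zero + x₂ * v (suc zero) + x₀ * v (suc (suc zero))
        permuted zero start = refl
        permuted zero finish = solve 3 (λ a b c → b :+ a :+ c := a :+ b :+ c) refl a₁ a₂ a₀
        permuted (suc zero) start = solve 3 (λ a b c → b :+ c :+ a := a :+ b :+ c) refl a₁ a₂ a₀
        permuted (suc zero) finish = solve 3 (λ a b c → c :+ b :+ a := a :+ b :+ c) refl a₁ a₂ a₀
        permuted (suc (suc zero)) start = solve 3 (λ a b c → c :+ a :+ b := a :+ b :+ c) refl a₁ a₂ a₀
        permuted (suc (suc zero)) finish = solve 3 (λ a b c → a :+ c :+ b := a :+ b :+ c) refl a₁ a₂ a₀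

    tip-pivoted : ∀ i e → tip (adjacent i e) (other e) ≡ tip i e
    tip-pivoted zero             start  = ≡.refl
    tip-pivoted zero             finish = ≡.refl
    tip-pivoted (suc zero)       start  = ≡.refl
    tip-pivoted (suc zero)       finish = ≡.refl
    tip-pivoted (suc (suc zero)) start  = ≡.refl
    tip-pivoted (suc (suc zero)) finish = ≡.refl

    other-involutive : ∀ e → other (other e) ≡ e
    other-involutive start  = ≡.refl
    other-involutive finish = ≡.refl

    -- A pivot keeps the vector at its vertex and replaces the vector at the other end of the side
    -- by that of the third vertex. The coefficient of the pivot matrix is the one in the linear
    -- relation of the three.
    pivot-frame : ∀ f → pivotM f ⊛ frame f ∼ frame (pivoted f)
    pivot-frame f@((t , i) , e) = ∼-exact (top (v₁ t)) (top (v₂ t))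
      (bottom (v₁ t) (ptolemy₁ t)) (bottom (v₂ t) (ptolemy₂ t))
      where
      open SetoidReasoning setoid hiding (start)
      s = sgn (pos f)
      xᵢ = x (t , i)
      xₐ = x (t , adjacent i e)
      x′ = x (t , adjacent i (other e))
      xᵢ⁻¹ = x⁻¹ (t , i)
      xₐ⁻¹ = x⁻¹ (t , adjacent i e)
      top : (v : Fin 3 → Carrier) → 1# * v (tip i e) + 0# * (s * xᵢ⁻¹ * v (tip i (other e))) ≈ v (tip (adjacent i e) (other e))
      top v = trans (1a+0b _ _) (reflexive (≡.cong v (≡.sym (tip-pivoted i e))))
      bottom : (v : Fin 3 → Carrier) →
               x (t , suc zero) * v zero + x (t , suc (suc zero)) * v (suc zero) + x (t , zero) * v (suc (suc zero)) ≈ 0# →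
               s * x′ * xᵢ⁻¹ * xₐ⁻¹ * v (tip i e) + 1# * (s * xᵢ⁻¹ * v (tip i (other e)))
               ≈ sgn (pos (pivoted f)) * xₐ⁻¹ * v (tip (adjacent i e) (other (other e)))
      bottom v rel = begin
        s * x′ * xᵢ⁻¹ * xₐ⁻¹ * p + 1# * (s * xᵢ⁻¹ * q)
          ≈⟨ +-congˡ (*-congʳ (x-inverse (t , adjacent i e))) ⟨
        s * x′ * xᵢ⁻¹ * xₐ⁻¹ * p + (xₐ * xₐ⁻¹) * (s * xᵢ⁻¹ * q)
          -- The vector `r` of the third vertex is added and subtracted: the bracket becomes the
          -- Ptolemy sum, and what remains is the new second row, with the sign of `pos` reversed.
          ≈⟨ solve 9 (λ s x′ xᵢ xₐ xᵢ⁻¹ xₐ⁻¹ p q r →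
               s :* x′ :* xᵢ⁻¹ :* xₐ⁻¹ :* p :+ (xₐ :* xₐ⁻¹) :* (s :* xᵢ⁻¹ :* q)
               := s :* xᵢ⁻¹ :* xₐ⁻¹ :* (x′ :* p :+ xₐ :* q :+ xᵢ :* r) :+ (:- s) :* xₐ⁻¹ :* ((xᵢ :* xᵢ⁻¹) :* r))
               refl s x′ xᵢ xₐ xᵢ⁻¹ xₐ⁻¹ p q r ⟩
        s * xᵢ⁻¹ * xₐ⁻¹ * (x′ * p + xₐ * q + xᵢ * r) + (- s) * xₐ⁻¹ * ((xᵢ * xᵢ⁻¹) * r)
          ≈⟨ +-cong (*-congˡ (ptolemy t v rel i e)) (*-cong (*-congʳ (sym (sgn-opposite (pos f)))) (*-congʳ (x-inverse (t , i)))) ⟩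
        s * xᵢ⁻¹ * xₐ⁻¹ * 0# + sgn (opposite (pos f)) * xₐ⁻¹ * (1# * r)
          ≈⟨ +-cong (zeroʳ _) (*-congˡ (*-identityˡ r)) ⟩
        0# + sgn (opposite (pos f)) * xₐ⁻¹ * r
          ≈⟨ +-identityˡ _ ⟩
        sgn (opposite (pos f)) * xₐ⁻¹ * r
          ≈⟨ reflexive (≡.cong₂ (λ s e′ → sgn s * xₐ⁻¹ * v (tip (adjacent i e) e′)) (≡.sym (pos-pivoted f)) (≡.sym (other-involutive e))) ⟩
        sgn (pos (pivoted f)) * xₐ⁻¹ * v (tip (adjacent i e) (other (other e))) ∎
        where
        p = v (tip i e)
        q = v (tip i (other e))
        r = v (tip (adjacent i e) e)

    slideAt : Flag T → Mat
    slideAt f@(h , _) = slideM (o f · o (slid f)) (pos f) h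

    -- A slide exchanges the two vectors of the frame, always with factor -1, for type 3 and type 3′
    -- alike.
    slide-frame : ∀ f → slideAt f ⊛ frame f ∼ frame (slid f)
    slide-frame f@((t , i) , e) = scaled ⊖ (top (v₁ t)) (top (v₂ t)) (bottom (v₁ t)) (bottom (v₂ t))
      where
      open SetoidReasoning setoid hiding (start)
      p = pos f
      q = (o f · o (slid f)) · p
      xᵢ = x (t , i)
      xᵢ⁻¹ = x⁻¹ (t , i)
      top : (v : Fin 3 → Carrier) →
            0# * v (tip i e) + sgn (opposite p) * xᵢ * (sgn p * xᵢ⁻¹ * v (tip i (other e)))
            ≈ sgn ⊖ * v (tip i (other e))
      top v = begin
        0# * v (tip i e) + sgn (opposite p) * xᵢ * (sgn p * xᵢ⁻¹ * w)   ≈⟨ +-cong (zeroˡ _) (*-congʳ (*-congʳ (sgn-opposite p))) ⟩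
        0# + (- sgn p) * xᵢ * (sgn p * xᵢ⁻¹ * w)                          ≈⟨ +-identityˡ _ ⟩
        (- sgn p) * xᵢ * (sgn p * xᵢ⁻¹ * w)
          ≈⟨ solve 4 (λ s x x⁻¹ w → (:- s) :* x :* (s :* x⁻¹ :* w) := :- (((s :* s) :* (x :* x⁻¹)) :* w)) refl (sgn p) xᵢ xᵢ⁻¹ w ⟩
        - (((sgn p * sgn p) * (xᵢ * xᵢ⁻¹)) * w)     ≈⟨ -‿cong (*-congʳ (*-cong (sgn² p) (x-inverse (t , i)))) ⟩
        - ((1# * 1#) * w)                           ≈⟨ -‿cong (*-congʳ (*-identityˡ 1#)) ⟩
        - (1# * w)                                  ≈⟨ -‿cong (*-identityˡ w) ⟩
        - w                                         ≈⟨ -1*x≈-x w ⟨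
        sgn ⊖ * w                                   ∎
        where w = v (tip i (other e))
      bottom : (v : Fin 3 → Carrier) →
               sgn q * xᵢ⁻¹ * v (tip i e) + 0# * (sgn p * xᵢ⁻¹ * v (tip i (other e)))
               ≈ sgn ⊖ * (sgn (pos (slid f)) * xᵢ⁻¹ * v (tip i (other (other e))))
      bottom v = begin
        sgn q * xᵢ⁻¹ * w + 0# * _                    ≈⟨ trans (+-congˡ (zeroˡ _)) (+-identityʳ _) ⟩
        sgn q * xᵢ⁻¹ * w
          ≈⟨ solve 3 (λ s x⁻¹ w → s :* x⁻¹ :* w := :- ((:- s) :* x⁻¹ :* w)) refl (sgn q) xᵢ⁻¹ w ⟩
        - ((- sgn q) * xᵢ⁻¹ * w)                     ≈⟨ -‿cong (*-congʳ (*-congʳ (sgn-opposite q))) ⟨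
        - (sgn (opposite q) * xᵢ⁻¹ * w)
          ≈⟨ reflexive (≡.cong₂ (λ s e → - (sgn s * xᵢ⁻¹ * v (tip i e))) (≡.sym (pos-slid f)) (≡.sym (other-involutive e))) ⟩
        - (sgn (pos (slid f)) * xᵢ⁻¹ * v (tip i (other (other e))))          ≈⟨ -1*x≈-x _ ⟨
        sgn ⊖ * (sgn (pos (slid f)) * xᵢ⁻¹ * v (tip i (other (other e))))    ∎
        where w = v (tip i e)

    -- The determinant of the two vertex vectors is ± the λ-length of the side, which the factor
    -- `x⁻¹` cancels. The order of the vectors at the two ends absorbs the difference between `pos`
    -- and `o`.
    det-frame : ∀ f → det (frame f) ≈ sgn (opposite (o f))
    det-frame f@((t , i) , start) = begin
      v₁ t i * (s * xᵢ⁻¹ * v₂ t (next i)) - v₂ t i * (s * xᵢ⁻¹ * v₁ t (next i))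
        ≈⟨ solve 6 (λ a b c d s x⁻¹ → a :* (s :* x⁻¹ :* d) :- b :* (s :* x⁻¹ :* c)
                    := s :* ((a :* d :- b :* c) :* x⁻¹)) refl
             (v₁ t i) (v₂ t i) (v₁ t (next i)) (v₂ t (next i)) s xᵢ⁻¹ ⟩
      s * ((v₁ t i * v₂ t (next i) - v₂ t i * v₁ t (next i)) * xᵢ⁻¹)   ≈⟨ *-congˡ (*-congʳ (det-vertices t i)) ⟩
      s * (x (t , i) * xᵢ⁻¹)     ≈⟨ *-congˡ (x-inverse (t , i)) ⟩
      s * 1#                     ≈⟨ *-identityʳ s ⟩
      s                          ∎
      where
      open SetoidReasoning setoid hiding (start)
      s = sgn (pos f)
      xᵢ⁻¹ = x⁻¹ (t , i)
    det-frame f@((t , i) , finish) = begin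
      v₁ t (next i) * (s * xᵢ⁻¹ * v₂ t i) - v₂ t (next i) * (s * xᵢ⁻¹ * v₁ t i)
        ≈⟨ solve 6 (λ a b c d s x⁻¹ → c :* (s :* x⁻¹ :* b) :- d :* (s :* x⁻¹ :* a)
                    := (:- s) :* ((a :* d :- b :* c) :* x⁻¹)) refl
             (v₁ t i) (v₂ t i) (v₁ t (next i)) (v₂ t (next i)) s xᵢ⁻¹ ⟩
      (- s) * ((v₁ t i * v₂ t (next i) - v₂ t i * v₁ t (next i)) * xᵢ⁻¹)   ≈⟨ *-congˡ (*-congʳ (det-vertices t i)) ⟩
      (- s) * (x (t , i) * xᵢ⁻¹)     ≈⟨ *-congˡ (x-inverse (t , i)) ⟩
      (- s) * 1#                     ≈⟨ *-identityʳ (- s) ⟩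
      - s                            ≈⟨ sgn-opposite (o f) ⟨
      sgn (opposite (o f))           ∎
      where
      open SetoidReasoning setoid hiding (start)
      s = sgn (pos f)
      xᵢ⁻¹ = x⁻¹ (t , i)

    frame-adj : ∀ f → frame f ⊛ adj (frame f) ∼ I
    frame-adj f = adj-inverseʳ (frame f) (opposite (o f)) (det-frame f)

    adj-frame : ∀ f → adj (frame f) ⊛ frame f ∼ I
    adj-frame f = adj-inverseˡ (frame f) (opposite (o f)) (det-frame f)

    -- Exponents of y, and crossing an arc at either end

    shearAt : Arc → Bool → ℤ
    shearAt τ s = b T L τ s ⊕

    turnShear-orient : ∀ ω r → turnShear (orient ω r) ≡ (ω ◃ 1) *ᶻ turnShear r
    turnShear-orient ⊕ clockwise        = ≡.refl
    turnShear-orient ⊕ counterclockwise = ≡.refl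
    turnShear-orient ⊖ clockwise        = ≡.refl
    turnShear-orient ⊖ counterclockwise = ≡.refl

    b-orient : ∀ τ s ω → b T L τ s ω ≡ (ω ◃ 1) *ᶻ shearAt τ s
    b-orient τ false ω = turnShear-orient ω (L τ)
    b-orient τ true  ω with twist τ
    ... | ⊕ = turnShear-orient ω (L τ)
    ... | ⊖ = lemma ω (L τ)
      where
      lemma : ∀ ω r → turnShear (orient (⊖ · ω) r) ≡ (ω ◃ 1) *ᶻ turnShear (orient ⊖ r)
      lemma ⊕ clockwise        = ≡.refl
      lemma ⊕ counterclockwise = ≡.refl
      lemma ⊖ clockwise        = ≡.refl
      lemma ⊖ counterclockwise = ≡.refl

    shearAt-not : ∀ τ s → shearAt τ (not s) ≡ (twist τ ◃ 1) *ᶻ shearAt τ s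
    shearAt-not τ false = ≡.trans (≡.cong (λ ω → turnShear (orient ω (L τ))) (Sign.*-identityʳ (twist τ)))
                                  (turnShear-orient (twist τ) (L τ))
    shearAt-not τ true with twist τ
    ... | ⊕ = ≡.sym (ℤ.*-identityˡ _)
    ... | ⊖ = lemma (L τ)
      where
      lemma : ∀ r → turnShear r ≡ -1ℤ *ᶻ turnShear (orient ⊖ r)
      lemma clockwise        = ≡.refl
      lemma counterclockwise = ≡.refl

    -- The local orientation enters twice, through the sense of the hop and through the sign of b,
    -- and cancels. Crossing at the other end reverses the sense and hence the exponent, as in
    -- `exponent-finish`.
    exponent-start : ∀ τ s → exponent τ s start ≡ shearAt τ s
    exponent-start τ s rewrite b-orient τ s (o (before τ s start)) = lemma (o (before τ s start)) (shearAt τ s)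
      where
      lemma : ∀ a k → (opposite (opposite a) ◃ 1) *ᶻ ((a ◃ 1) *ᶻ k) ≡ k
      lemma ⊕ k = ≡.trans (≡.sym (ℤ.*-assoc 1ℤ 1ℤ k)) (ℤ.*-identityˡ k)
      lemma ⊖ k = ≡.trans (≡.sym (ℤ.*-assoc -1ℤ -1ℤ k)) (ℤ.*-identityˡ k)

    exponent-finish : ∀ τ s → exponent τ s finish ≡ -ᶻ shearAt τ s
    exponent-finish τ s rewrite b-orient τ s (o (before τ s finish)) = lemma (o (before τ s finish)) (shearAt τ s)
      where
      lemma : ∀ a k → (opposite a ◃ 1) *ᶻ ((a ◃ 1) *ᶻ k) ≡ -ᶻ k
      lemma ⊕ k = ≡.trans (≡.sym (ℤ.*-assoc -1ℤ 1ℤ k)) (ℤ.-1*i≡-i k)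
      lemma ⊖ k = ≡.trans (≡.sym (ℤ.*-assoc 1ℤ -1ℤ k)) (ℤ.-1*i≡-i k)

    -- Exactly one of two things changes sign on the way back: for twist ⊕ the vertex is at the
    -- other end of the far side, for twist ⊖ the shear seen from the far side is negated.
    exponent-back : ∀ τ s → exponent τ (not s) (acrossEnd (twist τ) start) ≡ -ᶻ shearAt τ s
    exponent-back τ s with shearAt-not τ s
    ... | p with twist τ
    ... | ⊕ = ≡.trans (exponent-finish τ (not s)) (≡.cong -ᶻ_ (≡.trans p (ℤ.*-identityˡ _)))
    ... | ⊖ = ≡.trans (exponent-start τ (not s)) (≡.trans p (ℤ.-1*i≡-i _))

    acrossEnd-other : ∀ t e → acrossEnd t (other e) ≡ other (acrossEnd t e)
    acrossEnd-other ⊕ e = ≡.refl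
    acrossEnd-other ⊖ e = ≡.refl

    after-slid : ∀ τ s e → slid (after τ s e) ≡ after τ s (other e)
    after-slid τ s e = ≡.cong (arcSide τ (not s) ,_) (≡.sym (acrossEnd-other (twist τ) e))

    hopAt : Arc → Bool → End → Mat
    hopAt τ s e = hopM τ (exponent τ s e)

    -- Moving an antidiagonal matrix past a diagonal one exchanges the diagonal entries, whence
    -- `-ᶻ k` against `k`. On the far side τ is on the other hand, which negates the slide matrix.
    slide-hopM : ∀ τ k w p {σ σ′} → edge σ ≡ edge σ′ →
                 hopM τ (-ᶻ k) ⊛ slideM w p σ ∼ slideM w (opposite p) σ′ ⊛ hopM τ k
    slide-hopM τ k w p {σ} {σ′} σ≡σ′ = scaled ⊖
      (trans (trans (+-cong (zeroʳ _) (zeroˡ _)) (+-identityˡ 0#)) (negated (trans (+-cong (zeroˡ _) (zeroʳ _)) (+-identityˡ 0#)) -0#≈0#))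
      (begin
        y τ (-ᶻ -ᶻ k) * (sgn (opposite p) * x σ) + 0# * 0#
          ≈⟨ trans (+-congˡ (zeroˡ 0#)) (+-identityʳ _) ⟩
        y τ (-ᶻ -ᶻ k) * (sgn (opposite p) * x σ)
          ≈⟨ reflexive (≡.cong₂ (λ k ε → y τ k * (sgn (opposite p) * xᵉ ε)) (ℤ.neg-involutive k) σ≡σ′) ⟩
        y τ k * (sgn (opposite p) * x σ′)
          ≈⟨ solve 3 (λ y s x → y :* (s :* x) := :- ((:- s) :* x :* y)) refl (y τ k) (sgn (opposite p)) (x σ′) ⟩
        - ((- sgn (opposite p)) * x σ′ * y τ k)
          ≈⟨ negated (trans (+-cong (zeroˡ 0#) (*-congʳ (*-congʳ (sgn-opposite (opposite p))))) (+-identityˡ _)) refl ⟩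
        sgn ⊖ * (0# * 0# + sgn (opposite (opposite p)) * x σ′ * y τ k) ∎)
      (begin
        0# * 0# + y τ (-ᶻ k) * (sgn (w · p) * x⁻¹ σ)
          ≈⟨ trans (+-congʳ (zeroˡ 0#)) (+-identityˡ _) ⟩
        y τ (-ᶻ k) * (sgn (w · p) * x⁻¹ σ)
          ≈⟨ reflexive (≡.cong (λ ε → y τ (-ᶻ k) * (sgn (w · p) * xᵉ⁻¹ ε)) σ≡σ′) ⟩
        y τ (-ᶻ k) * (sgn (w · p) * x⁻¹ σ′)
          ≈⟨ solve 3 (λ y s x → y :* (s :* x) := :- ((:- s) :* x :* y)) refl (y τ (-ᶻ k)) (sgn (w · p)) (x⁻¹ σ′) ⟩
        - ((- sgn (w · p)) * x⁻¹ σ′ * y τ (-ᶻ k))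
          ≈⟨ negated (trans (+-cong (*-congʳ (*-congʳ (trans (reflexive (≡.cong sgn (·-opposite w))) (sgn-opposite (w · p))))) (zeroˡ 0#)) (+-identityʳ _)) refl ⟩
        sgn ⊖ * (sgn (w · opposite p) * x⁻¹ σ′ * y τ (-ᶻ k) + 0# * 0#) ∎)
      (trans (trans (+-cong (zeroˡ _) (zeroʳ _)) (+-identityˡ 0#)) (negated (trans (+-cong (zeroʳ _) (zeroˡ _)) (+-identityˡ 0#)) -0#≈0#))
      where
      open SetoidReasoning setoid hiding (start)
      negated : ∀ {a b c} → a ≈ b → - b ≈ c → c ≈ sgn ⊖ * a
      negated {a} p q = trans (sym q) (trans (-‿cong (sym p)) (sym (-1*x≈-x a)))
      ·-opposite : ∀ w → w · opposite p ≡ opposite (w · p)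
      ·-opposite ⊕ = ≡.refl
      ·-opposite ⊖ = ≡.refl

    slide-hop : ∀ τ s → hopAt τ s finish ⊛ slideAt (before τ s start)
                      ∼ slideAt (after τ s start) ⊛ hopAt τ s start
    slide-hop τ s = begin
      hopAt τ s finish ⊛ slideAt f
        ≡⟨ ≡.cong (λ k → hopM τ k ⊛ slideAt f) (exponent-finish τ s) ⟩
      hopM τ (-ᶻ shearAt τ s) ⊛ slideM w (pos f) (arcSide τ s)
        ≈⟨ slide-hopM τ (shearAt τ s) w (pos f) (edge-glued τ s) ⟩
      slideM w (opposite (pos f)) (arcSide τ (not s)) ⊛ hopM τ (shearAt τ s)
        ≡⟨ ≡.cong₂ (λ p k → slideM w p (arcSide τ (not s)) ⊛ hopM τ k) (pos-after τ s start) (exponent-start τ s) ⟨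
      slideM w (pos g) (arcSide τ (not s)) ⊛ hopAt τ s start
        ≡⟨ ≡.cong (λ w → slideM w (pos g) (arcSide τ (not s)) ⊛ hopAt τ s start) w′≡w ⟨
      slideAt g ⊛ hopAt τ s start ∎
      where
      open SetoidReasoning ∼-setoid hiding (start)
      f = before τ s start
      g = after τ s start
      w = o f · o (slid f)
      twist-cancels : ∀ t a b → (t · a) · (t · b) ≡ a · b
      twist-cancels ⊕ a b = ≡.refl
      twist-cancels ⊖ ⊕ ⊕ = ≡.refl
      twist-cancels ⊖ ⊕ ⊖ = ≡.refl
      twist-cancels ⊖ ⊖ ⊕ = ≡.refl
      twist-cancels ⊖ ⊖ ⊖ = ≡.refl
      w′≡w : o g · o (slid g) ≡ w
      w′≡w = ≡.trans
        (≡.cong₂ _·_ (o-hop τ s start) (≡.trans (≡.cong o (after-slid τ s start)) (o-hop τ s finish)))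
        (twist-cancels (twist τ) (o f) (o (slid f)))

    -- Taking the other ends of the two sides changes this only by a sign.
    crossingM : ∀ {t u} → Crossing T t u → Mat
    crossingM (cross τ s) = adj (frame (after τ s start)) ⊛ (hopAt τ s start ⊛ frame (before τ s start))

    -- At `start` this undoes the definition of `crossingM`. At `finish` the hop is compared with a
    -- detour: slide to the start, hop there, slide back on the far side.
    hop-frame : ∀ τ s e → hopAt τ s e ⊛ frame (before τ s e) ∼ frame (after τ s e) ⊛ crossingM (cross τ s)
    hop-frame τ s start = begin
      H ⊛ P                     ≈⟨ ⊛-identityˡ (H ⊛ P) ⟨
      I ⊛ (H ⊛ P)               ≈⟨ ⊛-congʳ (frame-adj (after τ s start)) ⟨
      (Q ⊛ adj Q) ⊛ (H ⊛ P)     ≈⟨ ⊛-assoc Q (adj Q) (H ⊛ P) ⟩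
      Q ⊛ (adj Q ⊛ (H ⊛ P))     ∎
      where
      open SetoidReasoning ∼-setoid hiding (start)
      H = hopAt τ s start
      P = frame (before τ s start)
      Q = frame (after τ s start)
    hop-frame τ s finish = begin
      H′ ⊛ frame (slid f)                  ≈⟨ ⊛-congˡ (slide-frame f) ⟨
      H′ ⊛ (slideAt f ⊛ frame f)           ≈⟨ ⊛-assoc H′ (slideAt f) (frame f) ⟨
      (H′ ⊛ slideAt f) ⊛ frame f           ≈⟨ ⊛-congʳ (slide-hop τ s) ⟩
      (slideAt g ⊛ H) ⊛ frame f            ≈⟨ ⊛-assoc (slideAt g) H (frame f) ⟩
      slideAt g ⊛ (H ⊛ frame f)            ≈⟨ ⊛-congˡ (hop-frame τ s start) ⟩
      slideAt g ⊛ (frame g ⊛ C)            ≈⟨ ⊛-assoc (slideAt g) (frame g) C ⟨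
      (slideAt g ⊛ frame g) ⊛ C            ≈⟨ ⊛-congʳ (slide-frame g) ⟩
      frame (slid g) ⊛ C                   ≡⟨ ≡.cong (λ h → frame h ⊛ C) (after-slid τ s start) ⟩
      frame (after τ s finish) ⊛ C         ∎
      where
      open SetoidReasoning ∼-setoid hiding (start)
      f = before τ s start
      g = after τ s start
      H = hopAt τ s start
      H′ = hopAt τ s finish
      C = crossingM (cross τ s)

    -- From paths to sequences of crossings

    walkM : ∀ {t u} → Walk T t u → Mat
    walkM ε       = I
    walkM (c ◅ w) = walkM w ⊛ crossingM c

    walkM-◅◅ : ∀ {t u v} (p : Walk T t u) (q : Walk T u v) → walkM (p ◅◅ q) ∼ walkM q ⊛ walkM p
    walkM-◅◅ ε       q = ∼-sym (⊛-identityʳ (walkM q))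
    walkM-◅◅ (c ◅ p) q = ∼-trans (⊛-congʳ (walkM-◅◅ p q)) (⊛-assoc (walkM q) (walkM p) (crossingM c))

    path-frame : ∀ {f g} (ρ : Star (Step T) f g) → pathM ρ ⊛ frame f ∼ frame g ⊛ walkM (shadow ρ)
    path-frame {f} ε = ∼-trans (⊛-identityˡ (frame f)) (∼-sym (⊛-identityʳ (frame f)))
    path-frame (_◅_ {f} {g} {h} s ρ) = begin
      (pathM ρ ⊛ stepM s) ⊛ frame f       ≈⟨ ⊛-assoc (pathM ρ) (stepM s) (frame f) ⟩
      pathM ρ ⊛ (stepM s ⊛ frame f)       ≈⟨ continue s ⟩
      frame h ⊛ walkM (shadow (s ◅ ρ))    ∎
      where
      open SetoidReasoning ∼-setoid hiding (start)
      continue : (s : Step T f g) → pathM ρ ⊛ (stepM s ⊛ frame f) ∼ frame h ⊛ walkM (shadow (s ◅ ρ))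
      continue (around (pivot f)) = ∼-trans (⊛-congˡ (pivot-frame f)) (path-frame ρ)
      continue (slide f)          = ∼-trans (⊛-congˡ (slide-frame f)) (path-frame ρ)
      continue (around (hop τ s e)) = begin
        pathM ρ ⊛ (hopAt τ s e ⊛ frame f)                ≈⟨ ⊛-congˡ (hop-frame τ s e) ⟩
        pathM ρ ⊛ (frame g ⊛ crossingM c)                ≈⟨ ⊛-assoc (pathM ρ) (frame g) (crossingM c) ⟨
        (pathM ρ ⊛ frame g) ⊛ crossingM c                ≈⟨ ⊛-congʳ (path-frame ρ) ⟩
        (frame h ⊛ walkM (shadow ρ)) ⊛ crossingM c       ≈⟨ ⊛-assoc (frame h) (walkM (shadow ρ)) (crossingM c) ⟩
        frame h ⊛ (walkM (shadow ρ) ⊛ crossingM c)       ∎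
        where c = cross τ s

    -- The path returns to the same flag, so `path-frame` has one frame on both sides and becomes a
    -- conjugation.
    tr-path : ∀ {f} (ρ : Star (Step T) f f) → tr (pathM ρ) ≈± tr (walkM (shadow ρ))
    tr-path {f} ρ = ≈±-trans (tr-cong conjugated) (≈±-trans (≈⇒≈± (tr-comm P (W ⊛ adj P))) (tr-cong cancelled))
      where
      open SetoidReasoning ∼-setoid hiding (start)
      P = frame f
      W = walkM (shadow ρ)
      conjugated : pathM ρ ∼ P ⊛ (W ⊛ adj P)
      conjugated = begin
        pathM ρ                    ≈⟨ ⊛-identityʳ (pathM ρ) ⟨
        pathM ρ ⊛ I                ≈⟨ ⊛-congˡ (frame-adj f) ⟨
        pathM ρ ⊛ (P ⊛ adj P)      ≈⟨ ⊛-assoc (pathM ρ) P (adj P) ⟨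
        (pathM ρ ⊛ P) ⊛ adj P      ≈⟨ ⊛-congʳ (path-frame ρ) ⟩
        (P ⊛ W) ⊛ adj P            ≈⟨ ⊛-assoc P W (adj P) ⟩
        P ⊛ (W ⊛ adj P)            ∎
      cancelled : (W ⊛ adj P) ⊛ P ∼ W
      cancelled = begin
        (W ⊛ adj P) ⊛ P            ≈⟨ ⊛-assoc W (adj P) P ⟩
        W ⊛ (adj P ⊛ P)            ≈⟨ ⊛-congˡ (adj-frame f) ⟩
        W ⊛ I                      ≈⟨ ⊛-identityʳ W ⟩
        W                          ∎

    -- Inverses and determinants of crossings

    hopM-inverse : ∀ τ k → hopM τ (-ᶻ k) ⊛ hopM τ k ∼ I
    hopM-inverse τ k = ∼-exact
      (trans (trans (+-congˡ (zeroˡ 0#)) (+-identityʳ _)) (trans (*-comm _ _) (y-inverse τ (-ᶻ k))))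
      (trans (+-cong (zeroʳ _) (zeroˡ _)) (+-identityˡ 0#))
      (trans (+-cong (zeroˡ _) (zeroʳ _)) (+-identityˡ 0#))
      (trans (trans (+-congʳ (zeroˡ 0#)) (+-identityˡ _)) (trans (*-comm _ _) (y-inverse τ k)))

    after-after : ∀ τ s → after τ (not s) (acrossEnd (twist τ) start) ≡ before τ s start
    after-after τ s = ≡.cong₂ (λ s e → arcSide τ s , e) (not-involutive s) (acrossEnd² (twist τ))
      where
      acrossEnd² : ∀ t → acrossEnd t (acrossEnd t start) ≡ start
      acrossEnd² ⊕ = ≡.refl
      acrossEnd² ⊖ = ≡.refl

    -- The return hop is made at the end `e′` where the first one arrived, so it leads back to the
    -- initial flag. `hop-frame` allows either end; the invertible frame `P` is then cancelled.
    crossing-not : ∀ τ s → crossingM (cross τ (not s)) ⊛ crossingM (cross τ s) ∼ I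
    crossing-not τ s = begin
      C′ ⊛ C                      ≈⟨ ⊛-identityˡ (C′ ⊛ C) ⟨
      I ⊛ (C′ ⊛ C)                ≈⟨ ⊛-congʳ (adj-frame f) ⟨
      (adj P ⊛ P) ⊛ (C′ ⊛ C)      ≈⟨ ⊛-assoc (adj P) P (C′ ⊛ C) ⟩
      adj P ⊛ (P ⊛ (C′ ⊛ C))      ≈⟨ ⊛-congˡ fixed ⟩
      adj P ⊛ P                   ≈⟨ adj-frame f ⟩
      I                           ∎
      where
      open SetoidReasoning ∼-setoid hiding (start)
      f = before τ s start
      g = after τ s start
      e′ = acrossEnd (twist τ) start
      P = frame f
      Q = frame g
      C = crossingM (cross τ s)
      C′ = crossingM (cross τ (not s))
      H = hopAt τ s start
      H′ = hopAt τ (not s) e′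
      H′H∼I : H′ ⊛ H ∼ I
      H′H∼I = begin
        H′ ⊛ H    ≡⟨ ≡.cong₂ (λ k l → hopM τ k ⊛ hopM τ l) (exponent-back τ s) (exponent-start τ s) ⟩
        hopM τ (-ᶻ shearAt τ s) ⊛ hopM τ (shearAt τ s)   ≈⟨ hopM-inverse τ (shearAt τ s) ⟩
        I         ∎
      fixed : P ⊛ (C′ ⊛ C) ∼ P
      fixed = begin
        P ⊛ (C′ ⊛ C)                             ≈⟨ ⊛-assoc P C′ C ⟨
        (P ⊛ C′) ⊛ C                             ≡⟨ ≡.cong (λ h → (frame h ⊛ C′) ⊛ C) (after-after τ s) ⟨
        (frame (after τ (not s) e′) ⊛ C′) ⊛ C    ≈⟨ ⊛-congʳ (hop-frame τ (not s) e′) ⟨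
        (H′ ⊛ Q) ⊛ C                             ≈⟨ ⊛-assoc H′ Q C ⟩
        H′ ⊛ (Q ⊛ C)                             ≈⟨ ⊛-congˡ (hop-frame τ s start) ⟨
        H′ ⊛ (H ⊛ P)                             ≈⟨ ⊛-assoc H′ H P ⟨
        (H′ ⊛ H) ⊛ P                             ≈⟨ ⊛-congʳ H′H∼I ⟩
        I ⊛ P                                    ≈⟨ ⊛-identityˡ P ⟩
        P                                        ∎

    crossing-backward : ∀ {t u} (c : Crossing T t u) → crossingM (backward c) ⊛ crossingM c ∼ I
    crossing-backward (cross τ false) = crossing-not τ false
    crossing-backward (cross τ true)  = crossing-not τ true

    det-crossing : ∀ τ s → det (crossingM (cross τ s)) ≈ sgn (twist τ)
    det-crossing τ s = begin
      det (adj Q ⊛ (H ⊛ P))            ≈⟨ trans (det-⊛ (adj Q) (H ⊛ P)) (*-cong (det-adj Q) (det-⊛ H P)) ⟩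
      det Q * (det H * det P)          ≈⟨ *-cong (det-frame g) (*-cong det-hop (det-frame f)) ⟩
      sgn (opposite (o g)) * (1# * sgn (opposite (o f)))
                                       ≈⟨ *-congˡ (*-identityˡ _) ⟩
      sgn (opposite (o g)) * sgn (opposite (o f))
                                       ≈⟨ sgn-* (opposite (o g)) (opposite (o f)) ⟨
      sgn (opposite (o g) · opposite (o f))
        ≡⟨ ≡.cong sgn (≡.trans (≡.cong (λ a → opposite a · opposite (o f)) (o-hop τ s start)) (lemma (twist τ) (o f))) ⟩
      sgn (twist τ)                    ∎
      where
      open SetoidReasoning setoid hiding (start)
      f = before τ s start
      g = after τ s start
      H = hopAt τ s start
      P = frame f
      Q = frame g
      k = exponent τ s start
      det-hop : det H ≈ 1#
      det-hop = trans (+-cong (trans (*-comm _ _) (y-inverse τ k)) (trans (-‿cong (zeroˡ 0#)) -0#≈0#)) (+-identityʳ 1#)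
      lemma : ∀ t a → opposite (t · a) · opposite a ≡ t
      lemma ⊕ ⊕ = ≡.refl
      lemma ⊕ ⊖ = ≡.refl
      lemma ⊖ ⊕ = ≡.refl
      lemma ⊖ ⊖ = ≡.refl

    det-walk : ∀ {t u} (w : Walk T t u) → det (walkM w) ≈ sgn (transport w)
    det-walk ε = trans (+-cong (*-identityˡ 1#) (trans (-‿cong (zeroˡ 0#)) -0#≈0#)) (+-identityʳ 1#)
    det-walk (c@(cross τ s) ◅ w) = begin
      det (walkM w ⊛ crossingM c)          ≈⟨ det-⊛ (walkM w) (crossingM c) ⟩
      det (walkM w) * det (crossingM c)    ≈⟨ *-cong (det-walk w) (det-crossing τ s) ⟩
      sgn (transport w) * sgn (twist τ)    ≈⟨ *-comm _ _ ⟩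
      sgn (twist τ) * sgn (transport w)    ≈⟨ sgn-* (twist τ) (transport w) ⟨
      sgn (transport (c ◅ w))              ∎
      where open SetoidReasoning setoid hiding (start)

    -- `reverse` runs with an accumulator, so the induction needs an arbitrary `p`; `p = ε` says
    -- that the reversed walk is inverse modulo sign.
    walkM-revApp : ∀ {t u v} (w : Walk T t u) (p : Walk T t v) →
                   walkM (revApp backward w p) ⊛ walkM w ∼ walkM p
    walkM-revApp ε       p = ⊛-identityʳ (walkM p)
    walkM-revApp (c ◅ w) p = begin
      V ⊛ (walkM w ⊛ C)                               ≈⟨ ⊛-assoc V (walkM w) C ⟨
      (V ⊛ walkM w) ⊛ C                               ≈⟨ ⊛-congʳ (walkM-revApp w (backward c ◅ p)) ⟩
      (walkM p ⊛ crossingM (backward c)) ⊛ C          ≈⟨ ⊛-assoc (walkM p) (crossingM (backward c)) C ⟩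
      walkM p ⊛ (crossingM (backward c) ⊛ C)          ≈⟨ ⊛-congˡ (crossing-backward c) ⟩
      walkM p ⊛ I                                     ≈⟨ ⊛-identityʳ (walkM p) ⟩
      walkM p                                         ∎
      where
      open SetoidReasoning ∼-setoid hiding (start)
      C = crossingM c
      V = walkM (revApp backward w (backward c ◅ p))

    -- Invariance of the trace under isotopy

    holonomyTrace : ClosedCurve T → Carrier
    holonomyTrace (closed w) = tr (walkM w)

    holonomyTrace-move : ∀ {β γ} → Move β γ → holonomyTrace β ≈± holonomyTrace γ
    holonomyTrace-move (bigon p c q) = tr-cong (begin
      walkM (p ◅◅ c ◅ backward c ◅ q)                             ≈⟨ walkM-◅◅ p (c ◅ backward c ◅ q) ⟩
      ((walkM q ⊛ crossingM (backward c)) ⊛ crossingM c) ⊛ walkM p  ≈⟨ ⊛-congʳ (⊛-assoc (walkM q) (crossingM (backward c)) (crossingM c)) ⟩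
      (walkM q ⊛ (crossingM (backward c) ⊛ crossingM c)) ⊛ walkM p  ≈⟨ ⊛-congʳ (⊛-congˡ (crossing-backward c)) ⟩
      (walkM q ⊛ I) ⊛ walkM p                                     ≈⟨ ⊛-congʳ (⊛-identityʳ (walkM q)) ⟩
      walkM q ⊛ walkM p                                           ≈⟨ walkM-◅◅ p q ⟨
      walkM (p ◅◅ q)                                              ∎)
      where open SetoidReasoning ∼-setoid hiding (start)
    holonomyTrace-move (rebase p q) =
      ≈±-trans (tr-cong (walkM-◅◅ p q))
        (≈±-trans (≈⇒≈± (tr-comm (walkM q) (walkM p))) (tr-cong (∼-sym (walkM-◅◅ q p))))
    holonomyTrace-move (invert w) =
      ≈±-sym (tr-inverse (walkM w) (walkM (reverse backward w)) (transport w) (det-walk w) (walkM-revApp w ε))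

    holonomyTrace-cong : ∀ {β γ} → β ≃ γ → holonomyTrace β ≈± holonomyTrace γ
    holonomyTrace-cong = gfold ≈±-isEquivalence holonomyTrace holonomyTrace-move

    tr-closedPath : ∀ {f β} (ρ : Star (Step T) f f) → closed (shadow ρ) ≃ β → tr (pathM ρ) ≈± holonomyTrace β
    tr-closedPath ρ ρ≃β = ≈±-trans (tr-path ρ) (holonomyTrace-cong ρ≃β)

    holonomyTrace-² : ∀ α → OneSided α →
                      holonomyTrace (α ²) ≈± holonomyTrace α * holonomyTrace α + (1# + 1#)
    holonomyTrace-² (closed w) oneSided = ≈±-trans (tr-cong (walkM-◅◅ w w)) (≈⇒≈± (begin
      tr (W ⊛ W)                         ≈⟨ tr-square W ⟩
      tr W * tr W - (det W + det W)      ≈⟨ +-congˡ (-‿cong (+-cong det≈-1 det≈-1)) ⟩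
      tr W * tr W - (- 1# + - 1#)        ≈⟨ solve 2 (λ a o → a :- (:- o :+ :- o) := a :+ (o :+ o)) refl (tr W * tr W) 1# ⟩
      tr W * tr W + (1# + 1#)            ∎))
      where
      open SetoidReasoning setoid hiding (start)
      W = walkM w
      det≈-1 : det W ≈ - 1#
      det≈-1 = trans (det-walk w) (reflexive (≡.cong sgn oneSided))

-- The ring of Laurent polynomials

open import Data.Integer.Base using (sign; ∣_∣)
open import Defs hiding (b; length)
open ≡ using (refl; sym; trans; cong; cong₂; subst; module ≡-Reasoning)

module _ {n : ℕ} where

  private
    Term : Set
    Term = ℤ × Vec ℤ n

  infixl 7 _∙_
  _∙_ : Term → Term → Term
  (c , d) ∙ (c′ , d′) = c *ᶻ c′ , zipWith _+ᶻ_ d d′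

  ∙-assoc : ∀ s t u → (s ∙ t) ∙ u ≡ s ∙ (t ∙ u)
  ∙-assoc (a , d) (b , e) (c , f) =
    cong₂ _,_ (ℤ.*-assoc a b c) (Vec.zipWith-assoc ℤ.+-assoc d e f)

  ∙-comm : ∀ s t → s ∙ t ≡ t ∙ s
  ∙-comm (a , d) (b , e) =
    cong₂ _,_ (ℤ.*-comm a b) (Vec.zipWith-comm ℤ.+-comm d e)

  termCoeff : Term → Vec ℤ n → ℤ
  termCoeff (c , d) e = if does (Vec.≡-dec ℤ._≟_ d e) then c else 0ℤ

  coeff-+ : ∀ (f g : Laurent n) e → coeff (f + g) e ≡ coeff f e +ᶻ coeff g e
  coeff-+ []            g e = sym (ℤ.+-identityˡ (coeff g e))
  coeff-+ ((c , d) ∷ f) g e =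
    trans (cong (h +ᶻ_) (coeff-+ f g e)) (sym (ℤ.+-assoc h (coeff f e) (coeff g e)))
    where h = termCoeff (c , d) e

  coeff-‿- : ∀ (f : Laurent n) e → coeff (- f) e ≡ -ᶻ coeff f e
  coeff-‿- []            e = refl
  coeff-‿- ((c , d) ∷ f) e with does (Vec.≡-dec ℤ._≟_ d e)
  ... | true  = trans (cong ((-ᶻ c) +ᶻ_) (coeff-‿- f e)) (sym (ℤ.neg-distrib-+ c (coeff f e)))
  ... | false = trans (cong (0ℤ +ᶻ_) (coeff-‿- f e)) (sym (ℤ.neg-distrib-+ 0ℤ (coeff f e)))

  -- Lets `does-⇔` trade the exponent test on a term multiplied by z^d for a test on the original
  -- term at e - d.
  shift-⇔ : ∀ (d d′ e : Vec ℤ n) →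
            (zipWith _+ᶻ_ d d′ ≡ e) ⇔ (d′ ≡ zipWith _+ᶻ_ (Vec.map -ᶻ_ d) e)
  shift-⇔ d d′ e = mk⇔
    (λ { refl → sym (begin
      zipWith _+ᶻ_ -d (zipWith _+ᶻ_ d d′)  ≡⟨ Vec.zipWith-assoc ℤ.+-assoc -d d d′ ⟨
      zipWith _+ᶻ_ (zipWith _+ᶻ_ -d d) d′  ≡⟨ cong (λ z → zipWith _+ᶻ_ z d′) (Vec.zipWith-inverseˡ ℤ.+-inverseˡ d) ⟩
      zipWith _+ᶻ_ (replicate n 0ℤ) d′      ≡⟨ Vec.zipWith-identityˡ ℤ.+-identityˡ d′ ⟩
      d′                                     ∎) })
    (λ { refl → begin
      zipWith _+ᶻ_ d (zipWith _+ᶻ_ -d e)   ≡⟨ Vec.zipWith-assoc ℤ.+-assoc d -d e ⟨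
      zipWith _+ᶻ_ (zipWith _+ᶻ_ d -d) e   ≡⟨ cong (λ z → zipWith _+ᶻ_ z e) (Vec.zipWith-inverseʳ ℤ.+-inverseʳ d) ⟩
      zipWith _+ᶻ_ (replicate n 0ℤ) e       ≡⟨ Vec.zipWith-identityˡ ℤ.+-identityˡ e ⟩
      e                                      ∎ })
    where
    open ≡-Reasoning
    -d = Vec.map -ᶻ_ d

  coeff-∙ : ∀ c d (f : Laurent n) e →
            coeff (map ((c , d) ∙_) f) e ≡ c *ᶻ coeff f (zipWith _+ᶻ_ (Vec.map -ᶻ_ d) e)
  coeff-∙ c d []              e = sym (ℤ.*-zeroʳ c)
  coeff-∙ c d ((c′ , d′) ∷ f) e
    rewrite does-⇔ (shift-⇔ d d′ e) (Vec.≡-dec ℤ._≟_ _ _) (Vec.≡-dec ℤ._≟_ _ _)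
          | coeff-∙ c d f e
    with does (Vec.≡-dec ℤ._≟_ d′ (zipWith _+ᶻ_ (Vec.map -ᶻ_ d) e))
  ... | true  = sym (ℤ.*-distribˡ-+ c c′ _)
  ... | false =
    trans (cong (_+ᶻ c *ᶻ a) (sym (ℤ.*-zeroʳ c))) (sym (ℤ.*-distribˡ-+ c 0ℤ a))
    where a = coeff f (zipWith _+ᶻ_ (Vec.map -ᶻ_ d) e)

  +-cong : ∀ {f f′ g g′ : Laurent n} → f ≈ f′ → g ≈ g′ → f + g ≈ f′ + g′
  +-cong {f} {f′} {g} {g′} p q e = begin
    coeff (f + g) e             ≡⟨ coeff-+ f g e ⟩
    coeff f e +ᶻ coeff g e     ≡⟨ cong₂ _+ᶻ_ (p e) (q e) ⟩
    coeff f′ e +ᶻ coeff g′ e   ≡⟨ coeff-+ f′ g′ e ⟨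
    coeff (f′ + g′) e           ∎
    where open ≡-Reasoning

  +-comm : ∀ (f g : Laurent n) → f + g ≈ g + f
  +-comm f g e = begin
    coeff (f + g) e          ≡⟨ coeff-+ f g e ⟩
    coeff f e +ᶻ coeff g e  ≡⟨ ℤ.+-comm (coeff f e) (coeff g e) ⟩
    coeff g e +ᶻ coeff f e  ≡⟨ coeff-+ g f e ⟨
    coeff (g + f) e          ∎
    where open ≡-Reasoning

  coeff-const : ∀ c e → coeff {n} (const c) e ≡ c *ᶻ coeff {n} (const 1ℤ) e
  coeff-const c e with does (Vec.≡-dec ℤ._≟_ (replicate n 0ℤ) e)
  ... | true  = trans (ℤ.+-identityʳ c) (sym (ℤ.*-identityʳ c))
  ... | false = sym (ℤ.*-zeroʳ c)

  const-0 : const {n} 0ℤ ≈ []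
  const-0 e = trans (coeff-const 0ℤ e) (ℤ.*-zeroˡ (coeff {n} (const 1ℤ) e))

  const-+ : ∀ a b → const {n} (a +ᶻ b) ≈ const a + const b
  const-+ a b e = begin
    coeff {n} (const (a +ᶻ b)) e               ≡⟨ coeff-const (a +ᶻ b) e ⟩
    (a +ᶻ b) *ᶻ u                             ≡⟨ ℤ.*-distribʳ-+ u a b ⟩
    a *ᶻ u +ᶻ b *ᶻ u                         ≡⟨ cong₂ _+ᶻ_ (coeff-const a e) (coeff-const b e) ⟨
    coeff (const a) e +ᶻ coeff (const b) e     ≡⟨ coeff-+ (const a) (const b) e ⟨
    coeff {n} (const a + const b) e             ∎
    where
    open ≡-Reasoning
    u = coeff {n} (const 1ℤ) e

  const-* : ∀ a b → const {n} a * const b ≡ const (a *ᶻ b)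
  const-* a b = cong (λ d → (a *ᶻ b , d) ∷ []) (Vec.zipWith-replicate _+ᶻ_ 0ℤ 0ℤ)

  +-inverseʳ : ∀ (f : Laurent n) → f + - f ≈ const 0ℤ
  +-inverseʳ f e = begin
    coeff (f + - f) e              ≡⟨ coeff-+ f (- f) e ⟩
    coeff f e +ᶻ coeff (- f) e    ≡⟨ cong (coeff f e +ᶻ_) (coeff-‿- f e) ⟩
    coeff f e +ᶻ (-ᶻ coeff f e)    ≡⟨ ℤ.+-inverseʳ (coeff f e) ⟩
    0ℤ                             ≡⟨ const-0 e ⟨
    coeff {n} (const 0ℤ) e         ∎
    where open ≡-Reasoning

  *-congˡ : ∀ (f : Laurent n) {g g′} → g ≈ g′ → f * g ≈ f * g′
  *-congˡ []            p e = refl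
  *-congˡ ((c , d) ∷ f) {g} {g′} p =
    +-cong {map ((c , d) ∙_) g} {map ((c , d) ∙_) g′} {f * g} {f * g′} (λ e → begin
      coeff (map ((c , d) ∙_) g) e                               ≡⟨ coeff-∙ c d g e ⟩
      c *ᶻ coeff g (zipWith _+ᶻ_ (Vec.map -ᶻ_ d) e)   ≡⟨ cong (c *ᶻ_) (p _) ⟩
      c *ᶻ coeff g′ (zipWith _+ᶻ_ (Vec.map -ᶻ_ d) e)  ≡⟨ coeff-∙ c d g′ e ⟨
      coeff (map ((c , d) ∙_) g′) e                              ∎)
    (*-congˡ f p)
    where open ≡-Reasoning

  -- The product recurses on its left factor. This expansion along the right one is the inductive
  -- step of commutativity, from which congruence in the left factor follows.
  coeff-*-∷ : ∀ (g : Laurent n) t f e →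
              coeff (g * (t ∷ f)) e ≡ coeff (map (t ∙_) g) e +ᶻ coeff (g * f) e
  coeff-*-∷ []      t f e = refl
  coeff-*-∷ (u ∷ g) t f e = begin
    coeff ((u ∙ t) ∷ (map (u ∙_) f + g * (t ∷ f))) e
      ≡⟨ cong (λ v → coeff (v ∷ (map (u ∙_) f + g * (t ∷ f))) e) (∙-comm u t) ⟩
    h +ᶻ coeff (map (u ∙_) f + g * (t ∷ f)) e
      ≡⟨ cong (h +ᶻ_) (coeff-+ (map (u ∙_) f) (g * (t ∷ f)) e) ⟩
    h +ᶻ (a +ᶻ coeff (g * (t ∷ f)) e)
      ≡⟨ cong (λ z → h +ᶻ (a +ᶻ z)) (coeff-*-∷ g t f e) ⟩
    h +ᶻ (a +ᶻ (b +ᶻ c))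
      ≡⟨ shuffle h a b c ⟩
    (h +ᶻ b) +ᶻ (a +ᶻ c)
      ≡⟨ cong ((h +ᶻ b) +ᶻ_) (coeff-+ (map (u ∙_) f) (g * f) e) ⟨
    (h +ᶻ b) +ᶻ coeff (map (u ∙_) f + g * f) e ∎
    where
    open ≡-Reasoning
    h = termCoeff (t ∙ u) e
    a = coeff (map (u ∙_) f) e
    b = coeff (map (t ∙_) g) e
    c = coeff (g * f) e
    shuffle : ∀ h a b c → h +ᶻ (a +ᶻ (b +ᶻ c)) ≡ (h +ᶻ b) +ᶻ (a +ᶻ c)
    shuffle = solve-∀

  *-comm : ∀ (f g : Laurent n) → f * g ≈ g * f
  *-comm []      g e = cong (λ h → coeff h e) (sym (List.cartesianProductWith-zeroʳ _∙_ g))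
  *-comm (t ∷ f) g e = begin
    coeff (map (t ∙_) g + f * g) e                  ≡⟨ coeff-+ (map (t ∙_) g) (f * g) e ⟩
    coeff (map (t ∙_) g) e +ᶻ coeff (f * g) e      ≡⟨ cong (coeff (map (t ∙_) g) e +ᶻ_) (*-comm f g e) ⟩
    coeff (map (t ∙_) g) e +ᶻ coeff (g * f) e      ≡⟨ coeff-*-∷ g t f e ⟨
    coeff (g * (t ∷ f)) e                           ∎
    where open ≡-Reasoning

  *-distribʳ : ∀ (h f g : Laurent n) → (f + g) * h ≡ f * h + g * h
  *-distribʳ h f g = List.cartesianProductWith-distribʳ-++ _∙_ f g h

  map-∙-* : ∀ t (f g : Laurent n) → map (t ∙_) f * g ≡ map (t ∙_) (f * g)
  map-∙-* t []      g = refl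
  map-∙-* t (u ∷ f) g = begin
    map ((t ∙ u) ∙_) g ++ map (t ∙_) f * g            ≡⟨ cong₂ _++_ (List.map-cong (∙-assoc t u) g) (map-∙-* t f g) ⟩
    map (λ v → t ∙ (u ∙ v)) g ++ map (t ∙_) (f * g)   ≡⟨ cong (λ z → z ++ _) (List.map-∘ g) ⟩
    map (t ∙_) (map (u ∙_) g) ++ map (t ∙_) (f * g)   ≡⟨ List.map-++ (t ∙_) (map (u ∙_) g) (f * g) ⟨
    map (t ∙_) (map (u ∙_) g ++ f * g)                ∎
    where open ≡-Reasoning

  *-assoc : ∀ (f g h : Laurent n) → (f * g) * h ≡ f * (g * h)
  *-assoc []      g h = refl
  *-assoc (t ∷ f) g h = begin
    (map (t ∙_) g + f * g) * h          ≡⟨ *-distribʳ h (map (t ∙_) g) (f * g) ⟩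
    map (t ∙_) g * h + (f * g) * h      ≡⟨ cong₂ _+_ (map-∙-* t g h) (*-assoc f g h) ⟩
    map (t ∙_) (g * h) + f * (g * h)    ∎
    where open ≡-Reasoning

  *-identityˡ : ∀ (f : Laurent n) → const 1ℤ * f ≡ f
  *-identityˡ f = begin
    map ((1ℤ , replicate n 0ℤ) ∙_) f ++ []  ≡⟨ List.++-identityʳ _ ⟩
    map ((1ℤ , replicate n 0ℤ) ∙_) f        ≡⟨ List.map-cong (λ (c , d) → cong₂ _,_ (ℤ.*-identityˡ c) (Vec.zipWith-identityˡ ℤ.+-identityˡ d)) f ⟩
    map (λ t → t) f                         ≡⟨ List.map-id f ⟩
    f                                       ∎
    where open ≡-Reasoning

-- The zero is `const 0ℤ` rather than the empty list, to agree literally with the zero entries of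
-- the step matrices.
laurentRing : ℕ → CommutativeRing _ _
laurentRing n = record
  { Carrier = Laurent n
  ; _≈_ = _≈_
  ; _+_ = _+_
  ; _*_ = _*_
  ; -_  = -_
  ; 0#  = const 0ℤ
  ; 1#  = const 1ℤ
  ; isCommutativeRing = record
    { isRing = record
      { +-isAbelianGroup = record
        { isGroup = record
          { isMonoid = record
            { isSemigroup = record
              { isMagma = record
                { isEquivalence = record
                  { refl  = λ _ → refl
                  ; sym   = λ p e → sym (p e)
                  ; trans = λ p q e → trans (p e) (q e)
                  }
                ; ∙-cong = λ {f} {f′} {g} {g′} → +-cong {n} {f} {f′} {g} {g′}
                }
              ; assoc = λ f g h e → cong (λ k → coeff k e) (List.++-assoc f g h)
              }
            ; identity = identityˡ , λ f e → trans (+-comm f (const 0ℤ) e) (identityˡ f e)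
            }
          ; inverse = (λ f e → trans (+-comm (- f) f e) (+-inverseʳ f e)) , +-inverseʳ
          ; ⁻¹-cong = λ {f} {g} p e →
              trans (coeff-‿- f e) (trans (cong -ᶻ_ (p e)) (sym (coeff-‿- g e)))
          }
        ; comm = +-comm
        }
      ; *-cong = λ {f} {f′} {g} {g′} p q e →
          trans (*-congˡ f {g} {g′} q e)
            (trans (*-comm f g′ e) (trans (*-congˡ g′ {f} {f′} p e) (*-comm g′ f′ e)))
      ; *-assoc = λ f g h e → cong (λ k → coeff k e) (*-assoc f g h)
      ; *-identity = (λ f e → cong (λ k → coeff k e) (*-identityˡ f))
                   , λ f e → trans (*-comm f (const 1ℤ) e) (cong (λ k → coeff k e) (*-identityˡ f))
      ; distrib = (λ f g h e → trans (*-comm f (g + h) e)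
                    (trans (cong (λ k → coeff k e) (*-distribʳ f g h))
                      (+-cong {n} {g * f} {f * g} {h * f} {f * h} (*-comm g f) (*-comm h f) e)))
                , λ f g h e → cong (λ k → coeff k e) (*-distribʳ f g h)
      }
    ; *-comm = *-comm
    }
  }
  where
  identityˡ : ∀ (f : Laurent n) → const 0ℤ + f ≈ f
  identityˡ f = +-cong {n} {const 0ℤ} {[]} {f} {f} const-0 (λ _ → refl)

power-inverseʳ : ∀ {n} (i : Fin n) k → power i k * power i (-ᶻ k) ≡ const 1ℤ
power-inverseʳ i k = cong (λ d → (1ℤ , d) ∷ []) (update i)
  where
  update : ∀ {n} (i : Fin n) →
           zipWith _+ᶻ_ (replicate n 0ℤ [ i ]≔ k) (replicate n 0ℤ [ i ]≔ (-ᶻ k)) ≡ replicate n 0ℤ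
  update {ℕ.suc n} zero    = cong₂ _∷_ (ℤ.+-inverseʳ k) (Vec.zipWith-replicate _+ᶻ_ 0ℤ 0ℤ)
  update {ℕ.suc n} (suc i) = cong (0ℤ ∷_) (update i)

const-morphism : ∀ n → +-*-rawRing -Raw-AlmostCommutative⟶ fromCommutativeRing (laurentRing n)
const-morphism n = record
  { ⟦_⟧    = const
  ; +-homo = const-+
  ; *-homo = λ a b e → cong (λ f → coeff f e) (sym (const-* {n} a b))
  ; -‿homo = λ a e → refl
  ; 0-homo = λ e → refl
  ; 1-homo = λ e → refl
  }

-- Evaluation at (1, ..., 1) and positivity

module _ {n : ℕ} where

  -- The value at z = (1 , … , 1).
  sum : Laurent n → ℤ
  sum []            = 0ℤ
  sum ((c , _) ∷ f) = c +ᶻ sum f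

  sum-+ : ∀ f g → sum (f + g) ≡ sum f +ᶻ sum g
  sum-+ []            g = sym (ℤ.+-identityˡ (sum g))
  sum-+ ((c , _) ∷ f) g = trans (cong (c +ᶻ_) (sum-+ f g)) (sym (ℤ.+-assoc c (sum f) (sum g)))

  sum-∙ : ∀ c d f → sum (map ((c , d) ∙_) f) ≡ c *ᶻ sum f
  sum-∙ c d []             = sym (ℤ.*-zeroʳ c)
  sum-∙ c d ((c′ , _) ∷ f) =
    trans (cong (c *ᶻ c′ +ᶻ_) (sum-∙ c d f)) (sym (ℤ.*-distribˡ-+ c c′ (sum f)))

  sum-* : ∀ f g → sum (f * g) ≡ sum f *ᶻ sum g
  sum-* []            g = sym (ℤ.*-zeroˡ (sum g))
  sum-* ((c , d) ∷ f) g = begin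
    sum (map ((c , d) ∙_) g + f * g)            ≡⟨ sum-+ (map ((c , d) ∙_) g) (f * g) ⟩
    sum (map ((c , d) ∙_) g) +ᶻ sum (f * g)     ≡⟨ cong₂ _+ᶻ_ (sum-∙ c d g) (sum-* f g) ⟩
    c *ᶻ sum g +ᶻ sum f *ᶻ sum g                ≡⟨ ℤ.*-distribʳ-+ (sum g) c (sum f) ⟨
    (c +ᶻ sum f) *ᶻ sum g                       ∎
    where open ≡-Reasoning

  remove : Vec ℤ n → Laurent n → Laurent n
  remove d = filter (λ (_ , d′) → ¬? (Vec.≡-dec ℤ._≟_ d′ d))

  sum-remove : ∀ d f → sum f ≡ coeff f d +ᶻ sum (remove d f)
  sum-remove d []             = refl
  sum-remove d ((c , d′) ∷ f) with does (Vec.≡-dec ℤ._≟_ d′ d)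
  ... | true  = trans (cong (c +ᶻ_) (sum-remove d f)) (sym (ℤ.+-assoc c (coeff f d) _))
  ... | false = begin
    c +ᶻ sum f                                     ≡⟨ cong (c +ᶻ_) (sum-remove d f) ⟩
    c +ᶻ (coeff f d +ᶻ sum (remove d f))           ≡⟨ ℤ.+-assoc c (coeff f d) _ ⟨
    (c +ᶻ coeff f d) +ᶻ sum (remove d f)           ≡⟨ cong (_+ᶻ sum (remove d f)) (ℤ.+-comm c (coeff f d)) ⟩
    (coeff f d +ᶻ c) +ᶻ sum (remove d f)           ≡⟨ ℤ.+-assoc (coeff f d) c _ ⟩
    coeff f d +ᶻ (c +ᶻ sum (remove d f))           ≡⟨ cong (_+ᶻ (c +ᶻ sum (remove d f))) (ℤ.+-identityˡ (coeff f d)) ⟨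
    (0ℤ +ᶻ coeff f d) +ᶻ (c +ᶻ sum (remove d f))   ∎
    where open ≡-Reasoning

  coeff-remove-≡ : ∀ d f → coeff (remove d f) d ≡ 0ℤ
  coeff-remove-≡ d []             = refl
  coeff-remove-≡ d ((c , d′) ∷ f) with does (Vec.≡-dec ℤ._≟_ d′ d) in eq
  ... | true  = coeff-remove-≡ d f
  ... | false rewrite eq = trans (ℤ.+-identityˡ _) (coeff-remove-≡ d f)

  coeff-remove-≢ : ∀ {d e} → ¬ d ≡ e → ∀ f → coeff (remove d f) e ≡ coeff f e
  coeff-remove-≢ d≢e []             = refl
  coeff-remove-≢ {d} {e} d≢e ((c , d′) ∷ f) with Vec.≡-dec ℤ._≟_ d′ d
  ... | no _ = cong (termCoeff (c , d′) e +ᶻ_) (coeff-remove-≢ d≢e f)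
  ... | yes refl rewrite dec-false (Vec.≡-dec ℤ._≟_ d e) d≢e =
    trans (coeff-remove-≢ d≢e f) (sym (ℤ.+-identityˡ (coeff f e)))

  -- Single terms may be negative and cancel against others with the same exponent, so the sum is
  -- taken one exponent at a time.
  sum-nonNegative : ∀ f → (∀ e → 0ℤ ≤ᶻ coeff f e) → 0ℤ ≤ᶻ sum f
  sum-nonNegative f = go (length f) f ℕ.≤-refl
    where
    go : ∀ m f → length f ℕ.≤ m → (∀ e → 0ℤ ≤ᶻ coeff f e) → 0ℤ ≤ᶻ sum f
    -- `m` bounds the length, since `remove d f` is not a structural part of `f`.
    go m       []                 _         _   = ℤ.≤-refl
    go (suc m) f@((c , d) ∷ f′) (s≤s |f′|≤m) f≥0 =
      subst (0ℤ ≤ᶻ_) (sym (sum-remove d f)) (ℤ.+-mono-≤ (f≥0 d) (go m (remove d f) shorter remove≥0))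
      where
      shorter : length (remove d f) ℕ.≤ m
      shorter with Vec.≡-dec ℤ._≟_ d d
      ... | yes _  = ℕ.≤-trans (List.length-filter _ f′) |f′|≤m
      ... | no d≢d = contradiction refl d≢d
      remove≥0 : ∀ e → 0ℤ ≤ᶻ coeff (remove d f) e
      remove≥0 e with Vec.≡-dec ℤ._≟_ d e
      ... | yes refl = ℤ.≤-reflexive (sym (coeff-remove-≡ d f))
      ... | no d≢e   = subst (0ℤ ≤ᶻ_) (sym (coeff-remove-≢ d≢e f)) (f≥0 e)

  square+2≰0 : ∀ (f g : Laurent n) → (∀ e → 0ℤ ≤ᶻ coeff g e) →
               ¬ g ≈ - const 1ℤ * (f * f + const (+ 2))
  -- Nonnegativity is first carried over to `h`, so `sum` need not be shown to respect `≈`. The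
  -- value of `h` at (1, ..., 1) is minus (an integer square plus 2), whatever the signs in `f`.
  square+2≰0 f g g≥0 g≈ = negative (sum f) (subst (0ℤ ≤ᶻ_) value
    (sum-nonNegative h (λ e → subst (0ℤ ≤ᶻ_) (g≈ e) (g≥0 e))))
    where
    h = - const 1ℤ * (f * f + const (+ 2))
    value : sum h ≡ -1ℤ *ᶻ (sum f *ᶻ sum f +ᶻ + 2)
    value = begin
      sum h                                  ≡⟨ sum-* (- const 1ℤ) (f * f + const (+ 2)) ⟩
      -1ℤ *ᶻ sum (f * f + const (+ 2))       ≡⟨ cong (-1ℤ *ᶻ_) (sum-+ (f * f) (const (+ 2))) ⟩
      -1ℤ *ᶻ (sum (f * f) +ᶻ + 2)            ≡⟨ cong (λ z → -1ℤ *ᶻ (z +ᶻ + 2)) (sum-* f f) ⟩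
      -1ℤ *ᶻ (sum f *ᶻ sum f +ᶻ + 2)         ∎
      where open ≡-Reasoning
    negative : ∀ i → ¬ 0ℤ ≤ᶻ -1ℤ *ᶻ (i *ᶻ i +ᶻ + 2)
    negative i p
      -- These expose `i *ᶻ i +ᶻ + 2` as a successor, so its negative computes and the inequality
      -- has no constructor.
      rewrite Sign.s*s≡+ (sign i) | ℤ.+◃n≡+n (∣ i ∣ ℕ.* ∣ i ∣) | ℕ.+-comm (∣ i ∣ ℕ.* ∣ i ∣) 2
      with () ← p

-- Specialisation to Laurent polynomials

module _ {T : Triangulation} (O : VertexOrientation T) (L : PrincipalLamination T) where
  open Triangulation T

  private
    R = laurentRing (#variables T)
    ι = const-morphism (#variables T)

  xᵉ : ℤ → Edge → Poly T
  xᵉ k η = power (join _ #arcs (inj₁ (join #arcs _ η))) k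

  open CommutativeRing R using (reflexive)

  xᵉ-inverse : ∀ η → xᵉ 1ℤ η * xᵉ -1ℤ η ≈ const 1ℤ
  xᵉ-inverse η = reflexive (power-inverseʳ (join _ #arcs (inj₁ (join #arcs _ η))) 1ℤ)

  y-inverse : ∀ τ k → y½ᵏ T τ k * y½ᵏ T τ (-ᶻ k) ≈ const 1ℤ
  y-inverse τ k = reflexive (power-inverseʳ (join (#arcs ℕ.+ #segments) _ (inj₂ τ)) k)

  open Algebra.Properties.Ring (CommutativeRing.ring R) using (-1*x≈-x)
  open Matrices R ι
  open Holonomy R ι O L (xᵉ 1ℤ) (xᵉ -1ℤ) xᵉ-inverse (y½ᵏ T) y-inverse
    hiding (x; x⁻¹)

  toMat : Matrix → Mat
  toMat A = mat (Matrix.m₁₁ A) (Matrix.m₁₂ A) (Matrix.m₂₁ A) (Matrix.m₂₂ A)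

  const-sgn : ∀ s → const (s ◃ 1) ≡ sgn s
  const-sgn ⊕ = refl
  const-sgn ⊖ = refl

  1*x : ∀ f → f ≈ sgn ⊕ * f
  1*x f e = cong (λ h → coeff h e) (sym (*-identityˡ f))

  -1*x : ∀ f → - f ≈ sgn ⊖ * f
  -1*x f e = sym (-1*x≈-x f e)

  slideMatrix∼slideM : ∀ s p σ → toMat (slideMatrix T s p σ) ∼ slideM s p σ
  slideMatrix∼slideM ⊕ ⊖ σ = ∼-exact (λ _ → refl) (1*x (x T σ)) (-1*x (x⁻¹ T σ)) (λ _ → refl)
  slideMatrix∼slideM ⊕ ⊕ σ = ∼-exact (λ _ → refl) (-1*x (x T σ)) (1*x (x⁻¹ T σ)) (λ _ → refl)
  slideMatrix∼slideM ⊖ ⊖ σ = ∼-exact (λ _ → refl) (1*x (x T σ)) (1*x (x⁻¹ T σ)) (λ _ → refl)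
  slideMatrix∼slideM ⊖ ⊕ σ = ∼-exact (λ _ → refl) (-1*x (x T σ)) (-1*x (x⁻¹ T σ)) (λ _ → refl)

  stepMatrix∼stepM : ∀ {f g} (s : Step T f g) → toMat (stepMatrix O L s) ∼ stepM s
  stepMatrix∼stepM (around (pivot f@((t , i) , e))) =
    ∼-exact {B = pivotM f} (λ _ → refl) (λ _ → refl)
      (reflexive (cong (λ c → c * x T (t , adjacent i (other e)) * x⁻¹ T (t , i) * x⁻¹ T (t , adjacent i e)) (const-sgn (position O L f))))
      (λ _ → refl)
  stepMatrix∼stepM (around (hop τ s e)) = ∼-refl
  stepMatrix∼stepM (slide f@(h , _)) = slideMatrix∼slideM (VertexOrientation.o O f · VertexOrientation.o O (slid f)) (position O L f) h

  pathMatrix∼pathM : ∀ {f g} (ρ : Star (Step T) f g) → toMat (pathMatrix O L ρ) ∼ pathM ρ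
  pathMatrix∼pathM ε       = ∼-refl
  pathMatrix∼pathM (s ◅ ρ) = ⊛-cong (pathMatrix∼pathM ρ) (stepMatrix∼stepM s)

  -- The right side does not mention the M-path behind `g`. This makes values computed from
  -- unrelated M-paths comparable.
  chi≈±holonomyTrace : ∀ β g → IsChi O L β g → g ≈± holonomyTrace β
  chi≈±holonomyTrace β g (ρ , g≈±tr , _) =
    ≈±-trans {g} {tr M} (up-to-sign g≈±tr)
      (≈±-trans {tr M} {tr (pathM path)} (tr-cong (pathMatrix∼pathM path)) (tr-closedPath path isotopic))
    where
    open MPath ρ
    M = toMat (pathMatrix O L path)
    up-to-sign : g ≈ tr M ⊎ g ≈ - tr M → g ≈± tr M
    up-to-sign (inj₁ p) = ⊕ , λ e → trans (p e) (1*x (tr M) e)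
    up-to-sign (inj₂ p) = ⊖ , λ e → trans (p e) (-1*x (tr M) e)

  chi-² : ∀ α → OneSided α → ∀ f g → IsChi O L α f → IsChi O L (α ²) g →
          g ≈± f * f + const (+ 2)
  chi-² α oneSided f g χf χg = ≈±-trans {g} {holonomyTrace (α ²)} (chi≈±holonomyTrace (α ²) g χg)
    (≈±-trans {holonomyTrace (α ²)} {H * H + (const 1ℤ + const 1ℤ)} (holonomyTrace-² α oneSided)
      (≈⇒≈± {H * H + (const 1ℤ + const 1ℤ)} {f * f + const (+ 2)}
        (+-cong {_} {H * H} {f * f} {const 1ℤ + const 1ℤ} {const (+ 2)}
          (λ e → sym (≈±-square {f} {H} (chi≈±holonomyTrace α f χf) e))
          (λ e → sym (const-+ 1ℤ 1ℤ e)))))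
    where H = holonomyTrace α

module _ {n : ℕ} where
  open Matrices (laurentRing n) (const-morphism n)

  absolute : ∀ (f g : Laurent n) → (∀ e → 0ℤ ≤ᶻ coeff g e) → g ≈± f * f + const (+ 2) →
             f * f ≈ g - const (+ 2)
  absolute f g g≥0 (⊖ , g≈) = contradiction g≈ (square+2≰0 f g g≥0)
  absolute f g g≥0 (⊕ , g≈) e = begin
    a                                    ≡⟨ ℤ.+-identityʳ a ⟨
    a +ᶻ 0ℤ                              ≡⟨ cong (a +ᶻ_) (ℤ.+-inverseʳ c) ⟨
    a +ᶻ (c +ᶻ -ᶻ c)                     ≡⟨ ℤ.+-assoc a c (-ᶻ c) ⟨
    (a +ᶻ c) +ᶻ -ᶻ c                     ≡⟨ cong₂ _+ᶻ_ coeff-g (coeff-‿- (const {n} (+ 2)) e) ⟨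
    coeff g e +ᶻ coeff (- const {n} (+ 2)) e   ≡⟨ coeff-+ g (- const (+ 2)) e ⟨
    coeff (g - const (+ 2)) e            ∎
    where
    open ≡-Reasoning
    a = coeff (f * f) e
    c = coeff {n} (const (+ 2)) e
    coeff-g : coeff g e ≡ a +ᶻ c
    coeff-g = begin
      coeff g e                                    ≡⟨ g≈ e ⟩
      coeff (const 1ℤ * (f * f + const (+ 2))) e   ≡⟨ cong (λ h → coeff h e) (*-identityˡ (f * f + const (+ 2))) ⟩
      coeff (f * f + const (+ 2)) e                ≡⟨ coeff-+ (f * f) (const (+ 2)) e ⟩
      a +ᶻ c                                       ∎

proposition7p4 : (T : Triangulation) → Connected T → Unpunctured T → ¬ Orientable T →
    (O : VertexOrientation T) (L : PrincipalLamination T) →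
    (α : ClosedCurve T) → OneSided α →
    (f g : Poly T) → IsChi O L α f → IsChi O L (α ²) g →
    f * f ≈ g - const (+ 2)
proposition7p4 T _ _ _ O L α oneSided f g χf χg@(_ , _ , g≥0) =
  absolute f g g≥0 (chi-² O L α oneSided f g χf χg)
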